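{- Let $d\ge0$, let $A=\mathrm{Aut}(X_{14})\cong F_{20}$, and let $W_d=S_6\wr S_d$ act on $V(H(d,6))=\{1,\ldots,6\}^d$ in product action, so that $W_0$ is the group of order $1$ acting on the one-point set and $\Gamma_0=X_{14}$, where $\Gamma_d=X_{14}\,\square\,H(d,6)$. Then $$\mathrm{Aut}(\Gamma_d)=A\times W_d,$$ and the regular subgroups of $\mathrm{Aut}(\Gamma_d)$ are precisely the groups $$R_\varphi=\{(a,c)\in A\times N_{W_d}(H): cH=\varphi(a)\},$$ where $H$ is a regular subgroup of $W_d$ and $\varphi:A\to N_{W_d}(H)/H$ is a homomorphism. Moreover $R_\varphi\cong H\rtimes_\psi A$, where $\psi:A\to\mathrm{Aut}(H)$ is the composite of $\varphi$ with the embedding of $N_{W_d}(H)/H$ into $\mathrm{Aut}(H)$ given by conjugation. Every $R_\varphi$ has a quotient isomorphic to $F_{20}$; in particular, $\Gamma_d$ is not a Cayley graph of an abelian group.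
   Context: $F_{20}=\langle a,b\mid a^5=b^4=1,\ bab^{ -1}=a^2\rangle$ is the Frobenius group of order $20$. Writing $(i,j)$ for $a^ib^j$, let $$S=\{(0,1),(0,2),(0,3),(1,0),(1,1),(1,2),(1,3),(2,0),(2,3),(3,0),(3,1),(3,3),(4,0),(4,1)\},$$ which is inverse-closed, and let $X_{14}=\mathrm{Cay}(F_{20},S)$, where $\mathrm{Cay}(G,S)$ is the graph with vertex set $G$ and $g\sim h$ if and only if $hg^{ -1}\in S$. The group $\mathrm{Aut}(X_{14})$ consists exactly of the right translations $x\mapsto xg$, $g\in F_{20}$. $H(d,6)=K_6^{\square d}$ is the Hamming graph, with vertex set $\{1,\ldots,6\}^d$, two vertices adjacent when they differ in exactly one coordinate; $H(0,6)$ is the one-vertex graph. $\square$ denotes the Cartesian product of graphs. In the product action of $S_6\wr S_d=S_6^d\rtimes S_d$ on $\{1,\ldots,6\}^d$, $S_6^d$ acts coordinatewise and $S_d$ permutes coordinates. $A\times W_d$ acts on $V(\Gamma_d)=V(X_{14})\times\{1,\ldots,6\}^d$ coordinatewise. A permutation group is regular if it is transitive with trivial point stabilizers. A graph is a Cayley graph of a group $K$ if it is isomorphic to $\mathrm{Cay}(K,S')$ for some inverse-closed $S'\subseteq K\setminus\{1_K\}$. The embedding of $N/H$ into $\mathrm{Aut}(H)$ given by conjugation, where $N=N_{W_d}(H)$, is the following: fix a base point $\omega_0\in\{1,\ldots,6\}^d$; the stabilizer $N_{\omega_0}$ is a complement to $H$ in $N$ and so maps isomorphically onto $N/H$; the inverse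 isomorphism $N/H\to N_{\omega_0}$ is followed by the (faithful) conjugation action of $N_{\omega_0}$ on $H$. -}

module Defs where

open import Algebra.Bundles using (Group; AbelianGroup)
open import Algebra.Construct.DirectProduct using () renaming (group to _×ᴳ_)
import Algebra.Construct.Pointwise as Pointwise
open import Algebra.Morphism.Structures using (IsGroupHomomorphism; IsGroupIsomorphism)
import Algebra.Morphism.Construct.Composition as Compose
import Algebra.Properties.Group as GroupProperties
import Algebra.Properties.Monoid.Mult as Mult
open import Data.Fin.Base using (Fin; toℕ)
open import Data.Fin using (#_)
open import Data.Fin.Properties using (all?; toℕ-fromℕ<) renaming (_≟_ to _≟ᶠ_)
open import Data.List.Base using (List; []; _∷_)
import Data.List.Membership.DecPropositional as DecMembership
open import Data.Nat.Base using (ℕ; zero; suc; _+_; _*_; _∸_; _^_; NonZero)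
open import Data.Nat.DivMod using (_mod_; _%_; _/_; m≡m%n+[m/n]*n; m%n<n)
import Data.Nat.Properties as ℕₚ
open import Data.Product using (Σ; Σ-syntax; ∃-syntax; _×_; _,_; proj₁; proj₂)
open import Data.Product.Function.NonDependent.Setoid using (_×-inverse_)
open import Data.Product.Properties using (≡-dec)
open import Data.Product.Relation.Binary.Pointwise.NonDependent using (_×ₛ_)
open import Data.Sum.Base using (_⊎_; inj₁; inj₂)
open import Data.Unit.Base using (⊤; tt)
open import Data.Vec.Functional.Relation.Binary.Equality.Setoid using (≋-setoid)
open import Function.Base using (id)
open import Function.Bundles using (Inverse; Equivalence; _⇔_; mk⇔)
import Function.Construct.Composition as FC
import Function.Construct.Identity as FI
import Function.Construct.Symmetry as FS
open import Level using (Level; 0ℓ; _⊔_) renaming (suc to lsuc)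
open import Relation.Binary.Bundles using (Setoid)
open import Relation.Binary.Definitions using (_Respects_; _Respects₂_; Symmetric)
open import Relation.Binary.PropositionalEquality as ≡ using (_≡_; _≢_)
import Relation.Binary.Reasoning.Setoid as SetoidReasoning
open import Relation.Nullary.Decidable using (Dec; _→-dec_; from-yes; from-no; map′)
open import Relation.Nullary.Negation using (¬_)
open import Relation.Unary using (Pred; _⊆_; _∈_)

private variable
  c c₁ c₂ ℓ ℓ₁ ℓ₂ r r₁ r₂ s : Level

record Hom (G H : Group 0ℓ 0ℓ) : Set where
  field
    ⟦_⟧                 : Group.Carrier G → Group.Carrier H
    isGroupHomomorphism : IsGroupHomomorphism (Group.rawGroup G) (Group.rawGroup H) ⟦_⟧

  open IsGroupHomomorphism isGroupHomomorphism public

infixl 8 _⟨$⟩_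
_⟨$⟩_ : {G H : Group 0ℓ 0ℓ} → Hom G H → Group.Carrier G → Group.Carrier H
_⟨$⟩_ = Hom.⟦_⟧

infix 4 _≅_
record _≅_ (G H : Group 0ℓ 0ℓ) : Set where
  field
    to    : Group.Carrier G → Group.Carrier H
    isIso : IsGroupIsomorphism (Group.rawGroup G) (Group.rawGroup H) to

  open IsGroupIsomorphism isIso public

module _ {G H : Group 0ℓ 0ℓ} where
  private
    module G = Group G
    module H = Group H
    module Hₚ = GroupProperties H

  mkHom : (f : G.Carrier → H.Carrier) →
          (∀ {x y} → x G.≈ y → f x H.≈ f y) →
          (∀ x y → f (x G.∙ y) H.≈ f x H.∙ f y) → Hom G H
  mkHom f f-cong f-homo = record
    { ⟦_⟧ = f
    ; isGroupHomomorphism = record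
      { isMonoidHomomorphism = record
        { isMagmaHomomorphism = record
          { isRelHomomorphism = record { cong = f-cong }
          ; homo = f-homo
          }
        ; ε-homo = f-ε
        }
      ; ⁻¹-homo = λ x → Hₚ.inverseˡ-unique _ _
          (H.trans (H.sym (f-homo _ _)) (H.trans (f-cong (G.inverseˡ x)) f-ε))
      }
    }
    where
    f-ε : f G.ε H.≈ H.ε
    f-ε = Hₚ.identityˡ-unique _ _
      (H.trans (H.sym (f-homo _ _)) (f-cong (G.identityˡ G.ε)))

module _ {G H : Group 0ℓ 0ℓ} where
  private
    module G = Group G
    module H = Group H

  inverseHom : G ≅ H → Hom H G
  inverseHom f = mkHom {H} {G} (λ y → proj₁ (f.surjective y))
    (λ {x} {y} x≈y → f.injective (H.trans (section x) (H.trans x≈y (H.sym (section y)))))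
    (λ x y → f.injective (H.trans (section _) (H.trans
      (H.∙-cong (H.sym (section x)) (H.sym (section y))) (H.sym (f.∙-homo _ _)))))
    where
    module f = _≅_ f
    section : ∀ y → f.to (proj₁ (f.surjective y)) H.≈ y
    section y = proj₂ (f.surjective y) G.refl

infixr 9 _∘ᴴ_
_∘ᴴ_ : {G H K : Group 0ℓ 0ℓ} → Hom H K → Hom G H → Hom G K
_∘ᴴ_ {G} {H} {K} g f = record
  { ⟦_⟧ = λ x → g ⟨$⟩ (f ⟨$⟩ x)
  ; isGroupHomomorphism = Compose.isGroupHomomorphism (Group.trans K)
      (Hom.isGroupHomomorphism f) (Hom.isGroupHomomorphism g)
  }

idᴴ : {G : Group 0ℓ 0ℓ} → Hom G G
idᴴ {G} = mkHom id id (λ _ _ → Group.refl G)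

record Subgroup (G : Group 0ℓ 0ℓ) : Set₁ where
  open Group G
  field
    Mem       : Pred Carrier 0ℓ
    resp      : Mem Respects _≈_
    ε-closed  : ε ∈ Mem
    ∙-closed  : ∀ {x y} → x ∈ Mem → y ∈ Mem → x ∙ y ∈ Mem
    ⁻¹-closed : ∀ {x} → x ∈ Mem → x ⁻¹ ∈ Mem

⌊_⌋ : {G : Group 0ℓ 0ℓ} → Subgroup G → Group 0ℓ 0ℓ
⌊_⌋ {G} K = record
  { Carrier = Σ Carrier K.Mem
  ; _≈_ = λ x y → proj₁ x ≈ proj₁ y
  ; _∙_ = λ x y → proj₁ x ∙ proj₁ y , K.∙-closed (proj₂ x) (proj₂ y)
  ; ε   = ε , K.ε-closed
  ; _⁻¹ = λ x → proj₁ x ⁻¹ , K.⁻¹-closed (proj₂ x)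
  ; isGroup = record
    { isMonoid = record
      { isSemigroup = record
        { isMagma = record
          { isEquivalence = record { refl = refl ; sym = sym ; trans = trans }
          ; ∙-cong = ∙-cong
          }
        ; assoc = λ _ _ _ → assoc _ _ _
        }
      ; identity = (λ _ → identityˡ _) , (λ _ → identityʳ _)
      }
    ; inverse = (λ _ → inverseˡ _) , (λ _ → inverseʳ _)
    ; ⁻¹-cong = ⁻¹-cong
    }
  }
  where
  open Group G
  module K = Subgroup K

inclusion : {G : Group 0ℓ 0ℓ} (K : Subgroup G) → Hom ⌊ K ⌋ G
inclusion {G} K = mkHom proj₁ id (λ _ _ → Group.refl G)

whole : (G : Group 0ℓ 0ℓ) → Subgroup G
whole G = record
  { Mem = λ _ → ⊤ ; resp = λ _ _ → tt ; ε-closed = tt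
  ; ∙-closed = λ _ _ → tt ; ⁻¹-closed = λ _ → tt }

module _ {G H : Group 0ℓ 0ℓ} (f : Hom G H) where
  private
    module G = Group G
    module H = Group H
    module f = Hom f

  image : Subgroup G → Subgroup H
  image K = record
    { Mem       = λ y → ∃[ x ] x ∈ K.Mem × f ⟨$⟩ x H.≈ y
    ; resp      = λ y≈z (x , x∈K , fx≈y) → x , x∈K , H.trans fx≈y y≈z
    ; ε-closed  = G.ε , K.ε-closed , f.ε-homo
    ; ∙-closed  = λ (x , x∈K , p) (y , y∈K , q) →
        x G.∙ y , K.∙-closed x∈K y∈K , H.trans (f.homo x y) (H.∙-cong p q)
    ; ⁻¹-closed = λ (x , x∈K , p) →
        x G.⁻¹ , K.⁻¹-closed x∈K , H.trans (f.⁻¹-homo x) (H.⁻¹-cong p)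
    }
    where module K = Subgroup K

  preimage : Subgroup H → Subgroup G
  preimage K = record
    { Mem       = λ x → f ⟨$⟩ x ∈ K.Mem
    ; resp      = λ x≈y → K.resp (f.⟦⟧-cong x≈y)
    ; ε-closed  = K.resp (H.sym f.ε-homo) K.ε-closed
    ; ∙-closed  = λ p q → K.resp (H.sym (f.homo _ _)) (K.∙-closed p q)
    ; ⁻¹-closed = λ p → K.resp (H.sym (f.⁻¹-homo _)) (K.⁻¹-closed p)
    }
    where module K = Subgroup K

record NormalSubgroup (G : Group 0ℓ 0ℓ) : Set₁ where
  open Group G
  field
    subgroup : Subgroup G
  open Subgroup subgroup public
  field
    normal : ∀ g {x} → x ∈ Mem → g ∙ x ∙ g ⁻¹ ∈ Mem

-- Elements of G / M are represented by elements of G, and x and y are equal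
-- when xM = yM, i.e. when x⁻¹y ∈ M.
module _ (G : Group 0ℓ 0ℓ) (M : NormalSubgroup G) where
  private
    open module G = Group G
    open GroupProperties G
    module M = NormalSubgroup M

    normal⁻¹ : ∀ g {x} → x ∈ M.Mem → g ⁻¹ ∙ x ∙ g ∈ M.Mem
    normal⁻¹ g p = M.resp (∙-congˡ (⁻¹-involutive g)) (M.normal (g ⁻¹) p)

  infix 4 _≈ᴹ_
  _≈ᴹ_ : Carrier → Carrier → Set
  x ≈ᴹ y = x ⁻¹ ∙ y ∈ M.Mem

  private
    open SetoidReasoning G.setoid

    ≈⇒≈ᴹ : ∀ {x y} → x ≈ y → x ≈ᴹ y
    ≈⇒≈ᴹ x≈y = M.resp (sym (trans (∙-congˡ (sym x≈y)) (inverseˡ _))) M.ε-closed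

    symᴹ : ∀ {x y} → x ≈ᴹ y → y ≈ᴹ x
    symᴹ {x} {y} p = M.resp (begin
      (x ⁻¹ ∙ y) ⁻¹     ≈⟨ ⁻¹-anti-homo-∙ _ _ ⟩
      y ⁻¹ ∙ x ⁻¹ ⁻¹    ≈⟨ ∙-congˡ (⁻¹-involutive x) ⟩
      y ⁻¹ ∙ x          ∎) (M.⁻¹-closed p)

    transᴹ : ∀ {x y z} → x ≈ᴹ y → y ≈ᴹ z → x ≈ᴹ z
    transᴹ {x} {y} {z} p q = M.resp (begin
      (x ⁻¹ ∙ y) ∙ (y ⁻¹ ∙ z)   ≈⟨ assoc _ _ _ ⟩
      x ⁻¹ ∙ (y ∙ (y ⁻¹ ∙ z))   ≈⟨ ∙-congˡ (sym (assoc _ _ _)) ⟩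
      x ⁻¹ ∙ (y ∙ y ⁻¹ ∙ z)     ≈⟨ ∙-congˡ (∙-congʳ (inverseʳ y)) ⟩
      x ⁻¹ ∙ (ε ∙ z)            ≈⟨ ∙-congˡ (identityˡ z) ⟩
      x ⁻¹ ∙ z                  ∎) (M.∙-closed p q)

    -- (xu)⁻¹(yv) = (u⁻¹(x⁻¹y)u)(u⁻¹v)
    ∙-congᴹ : ∀ {x y u v} → x ≈ᴹ y → u ≈ᴹ v → x ∙ u ≈ᴹ y ∙ v
    ∙-congᴹ {x} {y} {u} {v} p q = M.resp (begin
      (u ⁻¹ ∙ (x ⁻¹ ∙ y) ∙ u) ∙ (u ⁻¹ ∙ v)   ≈⟨ assoc _ _ _ ⟩
      u ⁻¹ ∙ (x ⁻¹ ∙ y) ∙ (u ∙ (u ⁻¹ ∙ v))   ≈⟨ ∙-congˡ (sym (assoc _ _ _)) ⟩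
      u ⁻¹ ∙ (x ⁻¹ ∙ y) ∙ (u ∙ u ⁻¹ ∙ v)     ≈⟨ ∙-congˡ (∙-congʳ (inverseʳ u)) ⟩
      u ⁻¹ ∙ (x ⁻¹ ∙ y) ∙ (ε ∙ v)            ≈⟨ ∙-congˡ (identityˡ v) ⟩
      u ⁻¹ ∙ (x ⁻¹ ∙ y) ∙ v                  ≈⟨ ∙-congʳ (sym (assoc _ _ _)) ⟩
      u ⁻¹ ∙ x ⁻¹ ∙ y ∙ v                    ≈⟨ ∙-congʳ (∙-congʳ (sym (⁻¹-anti-homo-∙ x u))) ⟩
      (x ∙ u) ⁻¹ ∙ y ∙ v                     ≈⟨ assoc _ _ _ ⟩
      (x ∙ u) ⁻¹ ∙ (y ∙ v)                   ∎)
      (M.∙-closed (normal⁻¹ u p) q)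

    -- x y⁻¹ = x (x⁻¹y)⁻¹ x⁻¹
    ⁻¹-congᴹ : ∀ {x y} → x ≈ᴹ y → x ⁻¹ ≈ᴹ y ⁻¹
    ⁻¹-congᴹ {x} {y} p = M.resp (begin
      x ∙ (y ⁻¹ ∙ x) ∙ x ⁻¹     ≈⟨ assoc _ _ _ ⟩
      x ∙ (y ⁻¹ ∙ x ∙ x ⁻¹)     ≈⟨ ∙-congˡ (assoc _ _ _) ⟩
      x ∙ (y ⁻¹ ∙ (x ∙ x ⁻¹))   ≈⟨ ∙-congˡ (∙-congˡ (inverseʳ x)) ⟩
      x ∙ (y ⁻¹ ∙ ε)            ≈⟨ ∙-congˡ (identityʳ _) ⟩
      x ∙ y ⁻¹                  ≈⟨ ∙-congʳ (sym (⁻¹-involutive x)) ⟩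
      x ⁻¹ ⁻¹ ∙ y ⁻¹            ∎) (M.normal x (symᴹ p))

  infixl 7 _/ᴳ_
  _/ᴳ_ : Group 0ℓ 0ℓ
  _/ᴳ_ = record
    { Carrier = Carrier
    ; _≈_ = _≈ᴹ_
    ; _∙_ = _∙_
    ; ε   = ε
    ; _⁻¹ = _⁻¹
    ; isGroup = record
      { isMonoid = record
        { isSemigroup = record
          { isMagma = record
            { isEquivalence = record
              { refl = ≈⇒≈ᴹ refl ; sym = symᴹ ; trans = transᴹ }
            ; ∙-cong = ∙-congᴹ
            }
          ; assoc = λ x y z → ≈⇒≈ᴹ (assoc x y z)
          }
        ; identity = (λ x → ≈⇒≈ᴹ (identityˡ x)) , (λ x → ≈⇒≈ᴹ (identityʳ x))
        }
      ; inverse = (λ x → ≈⇒≈ᴹ (inverseˡ x)) , (λ x → ≈⇒≈ᴹ (inverseʳ x))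
      ; ⁻¹-cong = ⁻¹-congᴹ
      }
    }

  projection : Hom G _/ᴳ_
  projection = mkHom id ≈⇒≈ᴹ (λ _ _ → ≈⇒≈ᴹ refl)

module Conjugation (G : Group 0ℓ 0ℓ) where
  private
    open module G = Group G
    open GroupProperties G
    open SetoidReasoning G.setoid

  conj : Carrier → Carrier → Carrier
  conj g x = g ∙ x ∙ g ⁻¹

  conj-cong : ∀ {g h x y} → g ≈ h → x ≈ y → conj g x ≈ conj h y
  conj-cong g≈h x≈y = ∙-cong (∙-cong g≈h x≈y) (⁻¹-cong g≈h)

  conj-ε : ∀ {g} x → g ≈ ε → conj g x ≈ x
  conj-ε {g} x g≈ε = begin
    g ∙ x ∙ g ⁻¹   ≈⟨ conj-cong g≈ε refl ⟩
    ε ∙ x ∙ ε ⁻¹   ≈⟨ ∙-cong (identityˡ x) ε⁻¹≈ε ⟩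
    x ∙ ε          ≈⟨ identityʳ x ⟩
    x              ∎

  conj-∙ : ∀ g h x → conj g (conj h x) ≈ conj (g ∙ h) x
  conj-∙ g h x = begin
    g ∙ (h ∙ x ∙ h ⁻¹) ∙ g ⁻¹      ≈⟨ ∙-congʳ (sym (assoc _ _ _)) ⟩
    g ∙ (h ∙ x) ∙ h ⁻¹ ∙ g ⁻¹      ≈⟨ ∙-congʳ (∙-congʳ (sym (assoc _ _ _))) ⟩
    g ∙ h ∙ x ∙ h ⁻¹ ∙ g ⁻¹        ≈⟨ assoc _ _ _ ⟩
    g ∙ h ∙ x ∙ (h ⁻¹ ∙ g ⁻¹)      ≈⟨ ∙-congˡ (sym (⁻¹-anti-homo-∙ g h)) ⟩
    (g ∙ h) ∙ x ∙ (g ∙ h) ⁻¹       ∎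

  conj-⁻¹ˡ : ∀ g x → conj (g ⁻¹) (conj g x) ≈ x
  conj-⁻¹ˡ g x = trans (conj-∙ (g ⁻¹) g x) (conj-ε x (inverseˡ g))

  conj-⁻¹ʳ : ∀ g x → conj g (conj (g ⁻¹) x) ≈ x
  conj-⁻¹ʳ g x = trans (conj-∙ g (g ⁻¹) x) (conj-ε x (inverseʳ g))

  conj-homo : ∀ g x y → conj g (x ∙ y) ≈ conj g x ∙ conj g y
  conj-homo g x y = begin
    g ∙ (x ∙ y) ∙ g ⁻¹                ≈⟨ ∙-congʳ (sym (assoc _ _ _)) ⟩
    g ∙ x ∙ y ∙ g ⁻¹                  ≈⟨ assoc _ _ _ ⟩
    g ∙ x ∙ (y ∙ g ⁻¹)                ≈⟨ ∙-congˡ (∙-congʳ (sym (identityˡ y))) ⟩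
    g ∙ x ∙ (ε ∙ y ∙ g ⁻¹)            ≈⟨ ∙-congˡ (∙-congʳ (∙-congʳ (sym (inverseˡ g)))) ⟩
    g ∙ x ∙ (g ⁻¹ ∙ g ∙ y ∙ g ⁻¹)     ≈⟨ ∙-congˡ (trans (∙-congʳ (assoc _ _ _)) (assoc _ _ _)) ⟩
    g ∙ x ∙ (g ⁻¹ ∙ (g ∙ y ∙ g ⁻¹))   ≈⟨ sym (assoc _ _ _) ⟩
    conj g x ∙ conj g y               ∎

module _ {G : Group 0ℓ 0ℓ} (K : Subgroup G) where
  private
    open module G = Group G
    open Conjugation G
    module K = Subgroup K

  normalizer : Subgroup G
  normalizer = record
    { Mem       = λ g → ∀ x → x ∈ K.Mem ⇔ (g ∙ x ∙ g ⁻¹ ∈ K.Mem)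
    ; resp      = λ g≈h N x → mk⇔
        (λ p → K.resp (conj-cong g≈h refl) (Equivalence.to (N x) p))
        (λ p → Equivalence.from (N x) (K.resp (conj-cong (sym g≈h) refl) p))
    ; ε-closed  = λ x → mk⇔ (K.resp (sym (conj-ε x refl))) (K.resp (conj-ε x refl))
    ; ∙-closed  = λ {g} {h} M N x → mk⇔
        (λ p → K.resp (conj-∙ g h x) (Equivalence.to (M _) (Equivalence.to (N x) p)))
        (λ p → Equivalence.from (N x) (Equivalence.from (M _) (K.resp (sym (conj-∙ g h x)) p)))
    ; ⁻¹-closed = λ {g} N x → mk⇔
        (λ p → Equivalence.from (N _) (K.resp (sym (conj-⁻¹ʳ g x)) p))
        (λ p → K.resp (conj-⁻¹ʳ g x) (Equivalence.to (N _) p))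
    }

  member⇒normalizes : K.Mem ⊆ normalizer .Subgroup.Mem
  member⇒normalizes {g} g∈K x = mk⇔
    (λ x∈K → K.∙-closed (K.∙-closed g∈K x∈K) (K.⁻¹-closed g∈K))
    (λ p → K.resp (conj-⁻¹ˡ g x)
      (K.∙-closed (K.∙-closed (K.⁻¹-closed g∈K) p) (K.⁻¹-closed (K.⁻¹-closed g∈K))))

  inNormalizer : NormalSubgroup ⌊ normalizer ⌋
  inNormalizer = record
    { subgroup = preimage (inclusion normalizer) K
    ; normal   = λ (_ , N) → Equivalence.to (N _)
    }

-- Permutations compose as functions, so actions are on the left.
Sym : Setoid 0ℓ 0ℓ → Group 0ℓ 0ℓ
Sym X = record
  { Carrier = Inverse X X
  ; _≈_ = λ f g → ∀ x → to f x ≈ to g x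
  ; _∙_ = λ f g → FC.inverse g f
  ; ε   = FI.inverse X
  ; _⁻¹ = FS.inverse
  ; isGroup = record
    { isMonoid = record
      { isSemigroup = record
        { isMagma = record
          { isEquivalence = record
            { refl  = λ _ → refl
            ; sym   = λ p x → sym (p x)
            ; trans = λ p q x → trans (p x) (q x)
            }
          ; ∙-cong = λ {f} {g} {h} {k} p q x → trans (to-cong f (q x)) (p (to k x))
          }
        ; assoc = λ _ _ _ _ → refl
        }
      ; identity = (λ _ _ → refl) , (λ _ _ → refl)
      }
    ; inverse = strictlyInverseʳ , strictlyInverseˡ
    ; ⁻¹-cong = λ {f} {g} p x → trans
        (from-cong f (sym (trans (p _) (strictlyInverseˡ g x))))
        (strictlyInverseʳ f (from g x))
    }
  }
  where
  open Setoid X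
  open Inverse

mkPermutation : (X : Setoid 0ℓ 0ℓ) (let open Setoid X)
                (f g : Carrier → Carrier) →
                (∀ {x y} → x ≈ y → f x ≈ f y) → (∀ {x y} → x ≈ y → g x ≈ g y) →
                (∀ x → f (g x) ≈ x) → (∀ x → g (f x) ≈ x) → Inverse X X
mkPermutation X f g f-cong g-cong fg gf = record
  { to = f ; from = g ; to-cong = f-cong ; from-cong = g-cong
  ; inverse = (λ p → trans (f-cong p) (fg _)) , (λ p → trans (g-cong p) (gf _))
  }
  where open Setoid X

Action : Group 0ℓ 0ℓ → Setoid 0ℓ 0ℓ → Set
Action G X = Hom G (Sym X)

module _ {G : Group 0ℓ 0ℓ} {X : Setoid 0ℓ 0ℓ} (ρ : Action G X) where
  private
    module G = Group G
    module X = Setoid X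
    module ρ = Hom ρ

  act : G.Carrier → X.Carrier → X.Carrier
  act g = Inverse.to (ρ ⟨$⟩ g)

  act-cong : ∀ g {x y} → x X.≈ y → act g x X.≈ act g y
  act-cong g = Inverse.to-cong (ρ ⟨$⟩ g)

  act-∙ : ∀ g h x → act (g G.∙ h) x X.≈ act g (act h x)
  act-∙ g h = ρ.homo g h

  act-⁻¹ : ∀ g x → act g (act (g G.⁻¹) x) X.≈ x
  act-⁻¹ g x = X.trans (X.sym (act-∙ g (g G.⁻¹) x))
    (X.trans (ρ.⟦⟧-cong (G.inverseʳ g) x) (ρ.ε-homo x))

  Faithful : Set
  Faithful = ∀ g → (∀ x → act g x X.≈ x) → g G.≈ G.ε

  stabilizer : X.Carrier → Subgroup G
  stabilizer x = record
    { Mem       = λ g → act g x X.≈ x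
    ; resp      = λ g≈h p → X.trans (X.sym (ρ.⟦⟧-cong g≈h x)) p
    ; ε-closed  = ρ.ε-homo x
    ; ∙-closed  = λ {g} {h} p q → X.trans (act-∙ g h x) (X.trans (act-cong g q) p)
    ; ⁻¹-closed = λ {g} p → X.trans (ρ.⁻¹-homo g x)
        (X.trans (Inverse.from-cong (ρ ⟨$⟩ g) (X.sym p)) (Inverse.strictlyInverseʳ (ρ ⟨$⟩ g) x))
    }

  IsTransitive : Subgroup G → Set
  IsTransitive K = ∀ x y → ∃[ g ] g ∈ K .Subgroup.Mem × act g x X.≈ y

  IsSemiregular : Subgroup G → Set
  IsSemiregular K = ∀ x {g} → g ∈ K .Subgroup.Mem → act g x X.≈ x → g G.≈ G.ε

  IsRegular : Subgroup G → Set
  IsRegular K = IsTransitive K × IsSemiregular K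

infixr 7 _×ᴬ_
_×ᴬ_ : {G H : Group 0ℓ 0ℓ} {X Y : Setoid 0ℓ 0ℓ} →
       Action G X → Action H Y → Action (G ×ᴳ H) (X ×ₛ Y)
ρ ×ᴬ σ = mkHom (λ (g , h) → (ρ ⟨$⟩ g) ×-inverse (σ ⟨$⟩ h))
  (λ (p , q) (x , y) → ρ.⟦⟧-cong p x , σ.⟦⟧-cong q y)
  (λ (g , h) (g′ , h′) (x , y) → ρ.homo g g′ x , σ.homo h h′ y)
  where
  module ρ = Hom ρ
  module σ = Hom σ

module _ (G : Group 0ℓ 0ℓ) where
  private
    module G = Group G

    isHom : {f : G.Carrier → G.Carrier} → (∀ {x y} → x G.≈ y → f x G.≈ f y) →
            (∀ x y → f (x G.∙ y) G.≈ f x G.∙ f y) →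
            IsGroupHomomorphism G.rawGroup G.rawGroup f
    isHom f-cong f-homo = Hom.isGroupHomomorphism
      (mkHom {G} {G} _ f-cong f-homo)

  open Inverse

  groupAutomorphisms : Subgroup (Sym G.setoid)
  groupAutomorphisms = record
    { Mem       = λ f → IsGroupHomomorphism G.rawGroup G.rawGroup (to f)
    ; resp      = λ {f} {g} f≈g p → isHom (to-cong g) λ x y →
        G.trans (G.sym (f≈g _)) (G.trans (IsGroupHomomorphism.homo p x y)
          (G.∙-cong (f≈g x) (f≈g y)))
    ; ε-closed  = isHom id (λ _ _ → G.refl)
    ; ∙-closed  = λ p q → Compose.isGroupHomomorphism G.trans q p
    ; ⁻¹-closed = λ {f} p → isHom (from-cong f) λ x y → G.trans
        (from-cong f (G.sym (G.trans (IsGroupHomomorphism.homo p _ _)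
          (G.∙-cong (strictlyInverseˡ f x) (strictlyInverseˡ f y)))))
        (strictlyInverseʳ f _)
    }

  AutGroup : Group 0ℓ 0ℓ
  AutGroup = ⌊ groupAutomorphisms ⌋

module _ {G : Group 0ℓ 0ℓ} (K : Subgroup G) where
  private
    open module G = Group G
    open Conjugation G
    module K = Subgroup K
    module N = Subgroup (normalizer K)

  conjugation : Hom ⌊ normalizer K ⌋ (AutGroup ⌊ K ⌋)
  conjugation = mkHom
    (λ n@(g , _) →
      mkPermutation (Group.setoid ⌊ K ⌋) (conjᴷ n) (conjᴷ (n N⁻¹))
        (conj-cong refl) (conj-cong refl)
        (λ (x , _) → conj-⁻¹ʳ g x) (λ (x , _) → conj-⁻¹ˡ g x)
      , Hom.isGroupHomomorphism (mkHom {⌊ K ⌋} {⌊ K ⌋} (conjᴷ n)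
          (conj-cong refl) (λ (x , _) (y , _) → conj-homo g x y)))
    (λ g≈h x → conj-cong g≈h refl)
    (λ (g , _) (h , _) (x , _) → sym (conj-∙ g h x))
    where
    open Group ⌊ normalizer K ⌋ using () renaming (_⁻¹ to _N⁻¹)
    conjᴷ : Group.Carrier ⌊ normalizer K ⌋ → Group.Carrier ⌊ K ⌋ → Group.Carrier ⌊ K ⌋
    conjᴷ (g , N) (x , x∈K) = conj g x , Equivalence.to (N x) x∈K

N/_ : {G : Group 0ℓ 0ℓ} (K : Subgroup G) → Group 0ℓ 0ℓ
N/ K = ⌊ normalizer K ⌋ /ᴳ inNormalizer K

module _ {G : Group 0ℓ 0ℓ} {X : Setoid 0ℓ 0ℓ} (ρ : Action G X)
         (H : Subgroup G) (reg : IsRegular ρ H) (ω : Setoid.Carrier X) where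
  private
    open module G = Group G
    open GroupProperties G
    open SetoidReasoning G.setoid
    module X = Setoid X
    module H = Subgroup H
    transitive   = proj₁ reg
    semiregular  = proj₂ reg

  normalizerStabilizer : Subgroup ⌊ normalizer H ⌋
  normalizerStabilizer = preimage (inclusion (normalizer H)) (stabilizer ρ ω)

  private module Stab = Subgroup (stabilizer ρ ω)

  stabilizer≅quotient : ⌊ normalizerStabilizer ⌋ ≅ N/ H
  stabilizer≅quotient = record
    { to    = π ⟨$⟩_
    ; isIso = record
      { isGroupMonomorphism = record
        { isGroupHomomorphism = Hom.isGroupHomomorphism π
        ; injective = λ {x} {y} → inj x y
        }
      ; surjective = surj
      }
    }
    where
    π : Hom ⌊ normalizerStabilizer ⌋ (N/ H)
    π = projection ⌊ normalizer H ⌋ (inNormalizer H) ∘ᴴ inclusion normalizerStabilizer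

    inj : ∀ (x y : Group.Carrier ⌊ normalizerStabilizer ⌋) →
          Group._≈_ (N/ H) (proj₁ x) (proj₁ y) → proj₁ (proj₁ x) ≈ proj₁ (proj₁ y)
    inj ((x , _) , xω≈ω) ((y , _) , yω≈ω) x⁻¹y∈H = begin
      x             ≈⟨ sym (⁻¹-involutive x) ⟩
      x ⁻¹ ⁻¹       ≈⟨ sym (inverseʳ-unique _ _ (semiregular ω x⁻¹y∈H
                         (Stab.∙-closed (Stab.⁻¹-closed xω≈ω) yω≈ω))) ⟩
      y             ∎

    surj : ∀ c → ∃[ n ] (∀ {z} → Group._≈_ ⌊ normalizerStabilizer ⌋ z n → Group._≈_ (N/ H) (proj₁ z) c)
    surj (c , c∈N) with transitive ω (act ρ (c ⁻¹) ω)
    ... | h , h∈H , hω≈c⁻¹ω =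
      ((c ∙ h , Subgroup.∙-closed (normalizer H) c∈N (member⇒normalizes H h∈H))
      , X.trans (act-∙ ρ c h ω) (X.trans (act-cong ρ c hω≈c⁻¹ω) (act-⁻¹ ρ c ω)))
      , λ {z} z≈ch → H.resp (begin
          h ⁻¹                            ≈⟨ sym (identityʳ _) ⟩
          h ⁻¹ ∙ ε                        ≈⟨ ∙-congˡ (sym (inverseˡ c)) ⟩
          h ⁻¹ ∙ (c ⁻¹ ∙ c)               ≈⟨ sym (assoc _ _ _) ⟩
          h ⁻¹ ∙ c ⁻¹ ∙ c                 ≈⟨ ∙-congʳ (sym (⁻¹-anti-homo-∙ c h)) ⟩
          (c ∙ h) ⁻¹ ∙ c                  ≈⟨ ∙-congʳ (⁻¹-cong (sym z≈ch)) ⟩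
          proj₁ (proj₁ z) ⁻¹ ∙ c          ∎) (H.⁻¹-closed h∈H)

  -- N/H → N_ω → Aut(H): the representative of a coset that fixes ω, acting on H
  -- by conjugation.
  quotientEmbedding : Hom (N/ H) (AutGroup ⌊ H ⌋)
  quotientEmbedding =
    conjugation H ∘ᴴ inclusion normalizerStabilizer ∘ᴴ inverseHom stabilizer≅quotient

module _ (H A : Group 0ℓ 0ℓ) (ψ : Hom A (AutGroup H)) where
  private
    module H = Group H
    module A = Group A
    module ψ = Hom ψ
    open SetoidReasoning H.setoid

    _▹_ : A.Carrier → H.Carrier → H.Carrier
    a ▹ h = Inverse.to (proj₁ (ψ ⟨$⟩ a)) h

    ▹-cong : ∀ {a b h k} → a A.≈ b → h H.≈ k → a ▹ h H.≈ b ▹ k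
    ▹-cong {a} {k = k} a≈b h≈k =
      H.trans (Inverse.to-cong (proj₁ (ψ ⟨$⟩ a)) h≈k) (ψ.⟦⟧-cong a≈b k)

    ▹-∙ : ∀ a h k → a ▹ (h H.∙ k) H.≈ (a ▹ h) H.∙ (a ▹ k)
    ▹-∙ a = IsGroupHomomorphism.homo (proj₂ (ψ ⟨$⟩ a))

    ▹-ε : ∀ a → a ▹ H.ε H.≈ H.ε
    ▹-ε a = IsGroupHomomorphism.ε-homo (proj₂ (ψ ⟨$⟩ a))

    ∙-▹ : ∀ a b h → (a A.∙ b) ▹ h H.≈ a ▹ (b ▹ h)
    ∙-▹ a b h = ψ.homo a b h

    ε-▹ : ∀ h → A.ε ▹ h H.≈ h
    ε-▹ h = ψ.ε-homo h

  infix 6 SemidirectProduct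
  syntax SemidirectProduct H A ψ = H ⋊[ ψ ] A
  SemidirectProduct : Group 0ℓ 0ℓ
  SemidirectProduct = record
    { Carrier = H.Carrier × A.Carrier
    ; _≈_ = λ (h , a) (k , b) → h H.≈ k × a A.≈ b
    ; _∙_ = λ (h , a) (k , b) → h H.∙ (a ▹ k) , a A.∙ b
    ; ε   = H.ε , A.ε
    ; _⁻¹ = λ (h , a) → (a A.⁻¹) ▹ (h H.⁻¹) , a A.⁻¹
    ; isGroup = record
      { isMonoid = record
        { isSemigroup = record
          { isMagma = record
            { isEquivalence = record
              { refl  = H.refl , A.refl
              ; sym   = λ (p , q) → H.sym p , A.sym q
              ; trans = λ (p , q) (p′ , q′) → H.trans p p′ , A.trans q q′
              }
            ; ∙-cong = λ (p , q) (p′ , q′) → H.∙-cong p (▹-cong q p′) , A.∙-cong q q′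
            }
          ; assoc = λ (h , a) (k , b) (l , c) →
              (begin
                (h H.∙ (a ▹ k)) H.∙ ((a A.∙ b) ▹ l)   ≈⟨ H.assoc _ _ _ ⟩
                h H.∙ ((a ▹ k) H.∙ ((a A.∙ b) ▹ l))   ≈⟨ H.∙-congˡ (H.∙-congˡ (∙-▹ a b l)) ⟩
                h H.∙ ((a ▹ k) H.∙ (a ▹ (b ▹ l)))     ≈⟨ H.∙-congˡ (H.sym (▹-∙ a k (b ▹ l))) ⟩
                h H.∙ (a ▹ (k H.∙ (b ▹ l)))           ∎)
              , A.assoc a b c
          }
        ; identity =
            (λ (h , a) → H.trans (H.identityˡ _) (ε-▹ h) , A.identityˡ a)
          , (λ (h , a) → H.trans (H.∙-congˡ (▹-ε a)) (H.identityʳ h) , A.identityʳ a)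
        }
      ; inverse =
          (λ (h , a) →
            H.trans (H.sym (▹-∙ (a A.⁻¹) (h H.⁻¹) h))
              (H.trans (▹-cong A.refl (H.inverseˡ h)) (▹-ε (a A.⁻¹)))
            , A.inverseˡ a)
        , (λ (h , a) →
            H.trans (H.∙-congˡ (H.trans (H.sym (∙-▹ a (a A.⁻¹) (h H.⁻¹)))
              (H.trans (▹-cong (A.inverseʳ a) H.refl) (ε-▹ _)))) (H.inverseʳ h)
            , A.inverseʳ a)
      ; ⁻¹-cong = λ (p , q) → ▹-cong (A.⁻¹-cong q) (H.⁻¹-cong p) , A.⁻¹-cong q
      }
    }

-- The power Kᵈ is the group of functions Fin d → K, and σ ∈ S_d permutes
-- coordinates by (σf)ᵢ = f_{σ⁻¹i}.
module _ (K : Group 0ℓ 0ℓ) (d : ℕ) where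
  private
    module K = Group K
    Kᵈ = Pointwise.group (Fin d) K

    ≡⇒≈ : (f : Fin d → K.Carrier) → ∀ {i j} → i ≡ j → f i K.≈ f j
    ≡⇒≈ f p = K.reflexive (≡.cong f p)

  permuteCoordinates : Hom (Sym (≡.setoid (Fin d))) (AutGroup Kᵈ)
  permuteCoordinates = mkHom
    (λ σ → mkPermutation (Group.setoid Kᵈ)
        (λ f i → f (from σ i)) (λ f i → f (to σ i))
        (λ p _ → p _) (λ p _ → p _)
        (λ f i → ≡⇒≈ f (strictlyInverseˡ σ i))
        (λ f i → ≡⇒≈ f (strictlyInverseʳ σ i))
      , Hom.isGroupHomomorphism (mkHom {Kᵈ} {Kᵈ} (λ f i → f (from σ i))
          (λ p _ → p _) (λ _ _ _ → K.refl)))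
    (λ {σ} {τ} σ≈τ f i → ≡⇒≈ f (Group.⁻¹-cong S {σ} {τ} σ≈τ i))
    (λ _ _ _ _ → K.refl)
    where
    open Inverse
    S = Sym (≡.setoid (Fin d))

  infixl 7 _≀S_
  _≀S_ : Group 0ℓ 0ℓ
  _≀S_ = Kᵈ ⋊[ permuteCoordinates ] Sym (≡.setoid (Fin d))

-- (f , σ) = (f , 1)(1 , σ) sends ω to the tuple with i-th entry fᵢ(ω_{σ⁻¹i}).
productAction : {K : Group 0ℓ 0ℓ} {X : Setoid 0ℓ 0ℓ} → Action K X →
                (d : ℕ) → Action (K ≀S d) (≋-setoid X d)
productAction {K} {X} ρ d = mkHom
  (λ (f , σ) → mkPermutation (≋-setoid X d)
    (λ ω i → to (ρ ⟨$⟩ f i) (ω (from σ i)))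
    (λ ω i → from (ρ ⟨$⟩ f (to σ i)) (ω (to σ i)))
    (λ p i → to-cong (ρ ⟨$⟩ f i) (p _))
    (λ p i → from-cong (ρ ⟨$⟩ f (to σ i)) (p _))
    (λ ω i → ≡.subst
      (λ j → to (ρ ⟨$⟩ f i) (from (ρ ⟨$⟩ f j) (ω j)) X.≈ ω i)
      (≡.sym (strictlyInverseˡ σ i)) (strictlyInverseˡ (ρ ⟨$⟩ f i) (ω i)))
    (λ ω i → X.trans (strictlyInverseʳ (ρ ⟨$⟩ f (to σ i)) _)
      (X.reflexive (≡.cong ω (strictlyInverseʳ σ i)))))
  (λ {(f , σ)} {(g , τ)} (f≈g , σ≈τ) ω i → X.trans (ρ.⟦⟧-cong (f≈g i) _)
    (to-cong (ρ ⟨$⟩ g i) (X.reflexive (≡.cong ω (S.⁻¹-cong {σ} {τ} σ≈τ i)))))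
  (λ (f , σ) (g , τ) ω i → ρ.homo (f i) (g (from σ i)) _)
  where
  open Inverse
  module X = Setoid X
  module ρ = Hom ρ
  module S = Group (Sym (≡.setoid (Fin d)))

module _ {A W : Group 0ℓ 0ℓ} (H : Subgroup W) (φ : Hom A (N/ H)) where
  private
    module A = Group A
    module W = Group W
    module N = Subgroup (normalizer H)
    module Q = Group (N/ H)
    module φ = Hom φ
    module π = Hom (projection ⌊ normalizer H ⌋ (inNormalizer H))

  -- {(a , c) ∈ A × N : cH = φ(a)}, with N the normalizer of H.  The components of
  -- Q._≈_ are representatives in N, so the equation says c⁻¹c′ ∈ H for φ(a) = c′H.
  cosetGraph : Subgroup (A ×ᴳ W)
  cosetGraph = record
    { Mem = λ (a , c) → Σ[ c∈N ∈ c ∈ N.Mem ] (c , c∈N) Q.≈ φ ⟨$⟩ a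
    ; resp = λ (a≈b , c≈e) (c∈N , p) → let e∈N = N.resp c≈e c∈N in
        e∈N , Q.trans {_ , e∈N} {_ , c∈N} {φ ⟨$⟩ _}
          (π.⟦⟧-cong {_ , e∈N} {_ , c∈N} (W.sym c≈e))
          (Q.trans {_ , c∈N} {φ ⟨$⟩ _} {φ ⟨$⟩ _} p (φ.⟦⟧-cong a≈b))
    ; ε-closed = N.ε-closed , Q.sym {φ ⟨$⟩ A.ε} {Q.ε} φ.ε-homo
    ; ∙-closed = λ {(a , c)} {(b , e)} (c∈N , p) (e∈N , q) →
        N.∙-closed c∈N e∈N ,
        Q.trans {(c , c∈N) Q.∙ (e , e∈N)} {(φ ⟨$⟩ a) Q.∙ (φ ⟨$⟩ b)} {φ ⟨$⟩ (a A.∙ b)}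
          (Q.∙-cong {c , c∈N} {φ ⟨$⟩ a} {e , e∈N} {φ ⟨$⟩ b} p q)
          (Q.sym {φ ⟨$⟩ (a A.∙ b)} {(φ ⟨$⟩ a) Q.∙ (φ ⟨$⟩ b)} (φ.homo a b))
    ; ⁻¹-closed = λ {(a , c)} (c∈N , p) →
        N.⁻¹-closed c∈N ,
        Q.trans {(c , c∈N) Q.⁻¹} {(φ ⟨$⟩ a) Q.⁻¹} {φ ⟨$⟩ (a A.⁻¹)}
          (Q.⁻¹-cong {c , c∈N} {φ ⟨$⟩ a} p)
          (Q.sym {φ ⟨$⟩ (a A.⁻¹)} {(φ ⟨$⟩ a) Q.⁻¹} (φ.⁻¹-homo a))
    }

record Graph c ℓ r : Set (lsuc (c ⊔ ℓ ⊔ r)) where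
  infix 4 _~_
  field
    V : Setoid c ℓ
  open Setoid V public
    using (_≈_)
    renaming (Carrier to Vertex; refl to ≈-refl; sym to ≈-sym; trans to ≈-trans)
  field
    _~_    : Vertex → Vertex → Set r
    ~-resp : _~_ Respects₂ _≈_
    ~-sym  : Symmetric _~_
    irrefl : ∀ {x} → ¬ (x ~ x)

PreservesEdges : (Γ : Graph c₁ ℓ₁ r₁) (Δ : Graph c₂ ℓ₂ r₂) →
                 (Graph.Vertex Γ → Graph.Vertex Δ) → Set (c₁ ⊔ r₁ ⊔ r₂)
PreservesEdges Γ Δ f = ∀ x y → x Γ.~ y ⇔ f x Δ.~ f y
  where
  module Γ = Graph Γ
  module Δ = Graph Δ

infix 4 _≅ᴳ_
_≅ᴳ_ : Graph c₁ ℓ₁ r₁ → Graph c₂ ℓ₂ r₂ → Set (c₁ ⊔ ℓ₁ ⊔ r₁ ⊔ c₂ ⊔ ℓ₂ ⊔ r₂)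
Γ ≅ᴳ Δ = Σ[ f ∈ Inverse (Graph.V Γ) (Graph.V Δ) ] PreservesEdges Γ Δ (Inverse.to f)

Aut : (Γ : Graph 0ℓ 0ℓ 0ℓ) → Subgroup (Sym (Graph.V Γ))
Aut Γ = record
  { Mem       = λ f → PreservesEdges Γ Γ (to f)
  ; resp      = λ f≈g p x y → mk⇔
      (λ e → ~-cong (f≈g x) (f≈g y) (Equivalence.to (p x y) e))
      (λ e → Equivalence.from (p x y) (~-cong (≈-sym (f≈g x)) (≈-sym (f≈g y)) e))
  ; ε-closed  = λ _ _ → mk⇔ id id
  ; ∙-closed  = λ {f} {g} p q x y → mk⇔
      (λ e → Equivalence.to (p _ _) (Equivalence.to (q _ _) e))
      (λ e → Equivalence.from (q _ _) (Equivalence.from (p _ _) e))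
  ; ⁻¹-closed = λ {f} p x y → mk⇔
      (λ e → Equivalence.from (p _ _)
        (~-cong (≈-sym (strictlyInverseˡ f x)) (≈-sym (strictlyInverseˡ f y)) e))
      (λ e → ~-cong (strictlyInverseˡ f x) (strictlyInverseˡ f y) (Equivalence.to (p _ _) e))
  }
  where
  open Graph Γ
  open Inverse
  ~-cong : ∀ {x x′ y y′} → x ≈ x′ → y ≈ y′ → x ~ y → x′ ~ y′
  ~-cong p q e = proj₂ ~-resp p (proj₁ ~-resp q e)

infixr 7 _□_
_□_ : Graph c₁ ℓ₁ r₁ → Graph c₂ ℓ₂ r₂ → Graph _ _ _
Γ □ Δ = record
  { V      = Γ.V ×ₛ Δ.V
  ; _~_    = λ (x , u) (y , v) → (x Γ.≈ y × u Δ.~ v) ⊎ (x Γ.~ y × u Δ.≈ v)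
  ; ~-resp =
      (λ { (p , q) (inj₁ (e , f)) → inj₁ (Γ.≈-trans e p , proj₁ Δ.~-resp q f)
         ; (p , q) (inj₂ (e , f)) → inj₂ (proj₁ Γ.~-resp p e , Δ.≈-trans f q) })
    , (λ { (p , q) (inj₁ (e , f)) → inj₁ (Γ.≈-trans (Γ.≈-sym p) e , proj₂ Δ.~-resp q f)
         ; (p , q) (inj₂ (e , f)) → inj₂ (proj₂ Γ.~-resp p e , Δ.≈-trans (Δ.≈-sym q) f) })
  ; ~-sym  = λ { (inj₁ (e , f)) → inj₁ (Γ.≈-sym e , Δ.~-sym f)
               ; (inj₂ (e , f)) → inj₂ (Γ.~-sym e , Δ.≈-sym f) }
  ; irrefl = λ { (inj₁ (_ , f)) → Δ.irrefl f ; (inj₂ (e , _)) → Γ.irrefl e }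
  }
  where
  module Γ = Graph Γ
  module Δ = Graph Δ

-- Adjacency in K_q^{□d}: the tuples differ in exactly one coordinate.
Hamming : ℕ → ℕ → Graph 0ℓ 0ℓ 0ℓ
Hamming d q = record
  { V      = ≋-setoid (≡.setoid (Fin q)) d
  ; _~_    = λ x y → ∃[ i ] x i ≢ y i × (∀ j → j ≢ i → x j ≡ y j)
  ; ~-resp =
      (λ y≈z (i , d , s) → i , (λ e → d (≡.trans e (≡.sym (y≈z i))))
        , λ j j≢i → ≡.trans (s j j≢i) (y≈z j))
    , (λ x≈z (i , d , s) → i , (λ e → d (≡.trans (x≈z i) e))
        , λ j j≢i → ≡.trans (≡.sym (x≈z j)) (s j j≢i))
  ; ~-sym  = λ (i , d , s) → i , (λ e → d (≡.sym e)) , λ j j≢i → ≡.sym (s j j≢i)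
  ; irrefl = λ (i , d , _) → d ≡.refl
  }

record ConnectionSet (G : Group c ℓ) s : Set (c ⊔ ℓ ⊔ lsuc s) where
  open Group G
  field
    Mem            : Pred Carrier s
    resp           : Mem Respects _≈_
    inverse-closed : ∀ {x} → x ∈ Mem → x ⁻¹ ∈ Mem
    ε∉             : ¬ (ε ∈ Mem)

Cay : (G : Group c ℓ) → ConnectionSet G s → Graph c ℓ s
Cay G S = record
  { V      = setoid
  ; _~_    = λ g h → h ∙ g ⁻¹ ∈ S.Mem
  ; ~-resp = (λ h≈k → S.resp (∙-congʳ h≈k)) , (λ g≈k → S.resp (∙-congˡ (⁻¹-cong g≈k)))
  ; ~-sym  = λ {g} {h} p → S.resp
      (trans (⁻¹-anti-homo-∙ h (g ⁻¹)) (∙-congʳ (⁻¹-involutive g))) (S.inverse-closed p)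
  ; irrefl = λ {g} p → S.ε∉ (S.resp (inverseʳ g) p)
  }
  where
  open Group G
  open GroupProperties G
  module S = ConnectionSet S

IsCayleyGraphOf : ∀ s → Graph c₁ ℓ₁ r₁ → Group c ℓ → Set _
IsCayleyGraphOf s Γ G = Σ[ S ∈ ConnectionSet G s ] Γ ≅ᴳ Cay G S

-- (i , j) stands for aⁱbʲ.  From bab⁻¹ = a² one gets bʲaᵏ = a^(2ʲk)bʲ, hence the
-- formulas below; 2⁴ = 1 mod 5 gives 2^(4∸j) as the inverse of 2ʲ.
F₂₀-elem : Set
F₂₀-elem = Fin 5 × Fin 4

infixl 7 _∙ᶠ_
_∙ᶠ_ : F₂₀-elem → F₂₀-elem → F₂₀-elem
(i , j) ∙ᶠ (k , l) = (toℕ i + 2 ^ toℕ j * toℕ k) mod 5 , (toℕ j + toℕ l) mod 4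

εᶠ : F₂₀-elem
εᶠ = Fin.zero , Fin.zero

infix 8 _⁻¹ᶠ
_⁻¹ᶠ : F₂₀-elem → F₂₀-elem
(i , j) ⁻¹ᶠ = (2 ^ (4 ∸ toℕ j) * (5 ∸ toℕ i)) mod 5 , (4 ∸ toℕ j) mod 4

infix 4 _≟_
_≟_ : (x y : F₂₀-elem) → Dec (x ≡ y)
_≟_ = ≡-dec _≟ᶠ_ _≟ᶠ_

all-pairs? : {P : Pred F₂₀-elem 0ℓ} → (∀ x → Dec (P x)) → Dec (∀ x → P x)
all-pairs? P? = map′ (λ p (i , j) → p i j) (λ p i j → p (i , j))
  (all? λ i → all? λ j → P? (i , j))

F₂₀ : Group 0ℓ 0ℓ
F₂₀ = record
  { Carrier = F₂₀-elem
  ; _≈_ = _≡_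
  ; _∙_ = _∙ᶠ_
  ; ε   = εᶠ
  ; _⁻¹ = _⁻¹ᶠ
  ; isGroup = record
    { isMonoid = record
      { isSemigroup = record
        { isMagma = record
          { isEquivalence = ≡.isEquivalence
          ; ∙-cong = ≡.cong₂ _∙ᶠ_
          }
        ; assoc = from-yes (all-pairs? λ x → all-pairs? λ y → all-pairs? λ z →
            ((x ∙ᶠ y) ∙ᶠ z) ≟ (x ∙ᶠ (y ∙ᶠ z)))
        }
      ; identity = from-yes (all-pairs? λ x → (εᶠ ∙ᶠ x) ≟ x)
                 , from-yes (all-pairs? λ x → (x ∙ᶠ εᶠ) ≟ x)
      }
    ; inverse = from-yes (all-pairs? λ x → (x ⁻¹ᶠ ∙ᶠ x) ≟ εᶠ)
              , from-yes (all-pairs? λ x → (x ∙ᶠ x ⁻¹ᶠ) ≟ εᶠ)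
    ; ⁻¹-cong = ≡.cong _⁻¹ᶠ
    }
  }

-- The group presented by generators X and relations R: words modulo the least
-- congruence that contains R and satisfies the group laws.
module Presentation (X : Set) where

  infixl 7 _·_
  infix 8 _⁻

  data Word : Set where
    gen : X → Word
    _·_ : Word → Word → Word
    1ʷ  : Word
    _⁻  : Word → Word

  infixr 8 _^ʷ_
  _^ʷ_ : Word → ℕ → Word
  w ^ʷ zero  = 1ʷ
  w ^ʷ suc n = w · w ^ʷ n

  module _ (R : Word → Word → Set) where

    infix 4 _∼_
    data _∼_ : Word → Word → Set where
      relation  : ∀ {u v} → R u v → u ∼ v
      refl      : ∀ {u} → u ∼ u
      sym       : ∀ {u v} → u ∼ v → v ∼ u
      trans     : ∀ {u v w} → u ∼ v → v ∼ w → u ∼ w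
      ·-cong    : ∀ {u v u′ v′} → u ∼ u′ → v ∼ v′ → u · v ∼ u′ · v′
      ⁻-cong    : ∀ {u v} → u ∼ v → u ⁻ ∼ v ⁻
      assoc     : ∀ u v w → (u · v) · w ∼ u · (v · w)
      identityˡ : ∀ u → 1ʷ · u ∼ u
      identityʳ : ∀ u → u · 1ʷ ∼ u
      inverseˡ  : ∀ u → u ⁻ · u ∼ 1ʷ
      inverseʳ  : ∀ u → u · u ⁻ ∼ 1ʷ

    presented : Group 0ℓ 0ℓ
    presented = record
      { Carrier = Word
      ; _≈_ = _∼_
      ; _∙_ = _·_
      ; ε   = 1ʷ
      ; _⁻¹ = _⁻
      ; isGroup = record
        { isMonoid = record
          { isSemigroup = record
            { isMagma = record
              { isEquivalence = record { refl = refl ; sym = sym ; trans = trans }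
              ; ∙-cong = ·-cong
              }
            ; assoc = assoc
            }
          ; identity = identityˡ , identityʳ
          }
        ; inverse = inverseˡ , inverseʳ
        ; ⁻¹-cong = ⁻-cong
        }
      }

    module _ (G : Group 0ℓ 0ℓ) (f : X → Group.Carrier G) where
      private module G = Group G

      evaluate : Word → G.Carrier
      evaluate (gen x) = f x
      evaluate (u · v) = evaluate u G.∙ evaluate v
      evaluate 1ʷ      = G.ε
      evaluate (u ⁻)   = evaluate u G.⁻¹

      evaluate-cong : (∀ {u v} → R u v → evaluate u G.≈ evaluate v) →
                      ∀ {u v} → u ∼ v → evaluate u G.≈ evaluate v
      evaluate-cong r (relation p)    = r p
      evaluate-cong r refl            = G.refl
      evaluate-cong r (sym p)         = G.sym (evaluate-cong r p)
      evaluate-cong r (trans p q)     = G.trans (evaluate-cong r p) (evaluate-cong r q)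
      evaluate-cong r (·-cong p q)    = G.∙-cong (evaluate-cong r p) (evaluate-cong r q)
      evaluate-cong r (⁻-cong p)      = G.⁻¹-cong (evaluate-cong r p)
      evaluate-cong r (assoc _ _ _)   = G.assoc _ _ _
      evaluate-cong r (identityˡ _)   = G.identityˡ _
      evaluate-cong r (identityʳ _)   = G.identityʳ _
      evaluate-cong r (inverseˡ _)    = G.inverseˡ _
      evaluate-cong r (inverseʳ _)    = G.inverseʳ _

data Generator : Set where
  𝐚 𝐛 : Generator

open Presentation Generator using (Word; gen; _·_; 1ʷ; _⁻; _^ʷ_; presented; relation)

data F₂₀-relation : Word → Word → Set where
  a⁵≈1     : F₂₀-relation (gen 𝐚 ^ʷ 5) 1ʷ
  b⁴≈1     : F₂₀-relation (gen 𝐛 ^ʷ 4) 1ʷ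
  bab⁻¹≈a² : F₂₀-relation (gen 𝐛 · gen 𝐚 · gen 𝐛 ⁻) (gen 𝐚 ^ʷ 2)

-- ⟨ a , b ∣ a⁵ = b⁴ = 1 , bab⁻¹ = a² ⟩
F₂₀-presented : Group 0ℓ 0ℓ
F₂₀-presented = presented F₂₀-relation

private
  module F = Group F₂₀-presented
  open Mult F.monoid using (×-homo-+; ×-assocˡ; ×-congʳ; ×-congˡ)
    renaming (_×_ to _times_)
  open SetoidReasoning F.setoid

  ā b̄ : Word
  ā = gen 𝐚
  b̄ = gen 𝐛

  word : F₂₀-elem → Word
  word (i , j) = toℕ i times ā F.∙ toℕ j times b̄

  times-ε : ∀ n → n times F.ε F.≈ F.ε
  times-ε zero    = F.refl
  times-ε (suc n) = F.trans (F.identityˡ _) (times-ε n)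

  reduce : ∀ {x n} .{{_ : NonZero n}} → n times x F.≈ F.ε →
           ∀ m → toℕ (m mod n) times x F.≈ m times x
  reduce {x} {n} xⁿ≈ε m = begin
    toℕ (m mod n) times x                      ≈⟨ ×-congˡ (toℕ-fromℕ< (m%n<n m n)) ⟩
    (m % n) times x                            ≈⟨ F.sym (F.identityʳ _) ⟩
    (m % n) times x F.∙ F.ε                    ≈⟨ F.∙-congˡ (F.sym (times-ε (m / n))) ⟩
    (m % n) times x F.∙ (m / n) times F.ε      ≈⟨ F.∙-congˡ (×-congʳ (m / n) (F.sym xⁿ≈ε)) ⟩
    (m % n) times x F.∙ (m / n) times (n times x)
                                               ≈⟨ F.∙-congˡ (×-assocˡ x (m / n) n) ⟩
    (m % n) times x F.∙ (m / n * n) times x    ≈⟨ F.sym (×-homo-+ x (m % n) (m / n * n)) ⟩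
    (m % n + m / n * n) times x                ≈⟨ ×-congˡ (≡.sym (m≡m%n+[m/n]*n m n)) ⟩
    m times x                                  ∎

  ba : b̄ F.∙ ā F.≈ 2 times ā F.∙ b̄
  ba = begin
    b̄ F.∙ ā                        ≈⟨ F.sym (F.identityʳ _) ⟩
    b̄ F.∙ ā F.∙ F.ε                ≈⟨ F.∙-congˡ (F.sym (F.inverseˡ b̄)) ⟩
    b̄ F.∙ ā F.∙ (b̄ ⁻ F.∙ b̄)        ≈⟨ F.sym (F.assoc _ _ _) ⟩
    b̄ F.∙ ā F.∙ b̄ ⁻ F.∙ b̄          ≈⟨ F.∙-congʳ (relation bab⁻¹≈a²) ⟩
    2 times ā F.∙ b̄                ∎

  baᵏ : ∀ k → b̄ F.∙ k times ā F.≈ (k * 2) times ā F.∙ b̄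
  baᵏ zero    = F.trans (F.identityʳ _) (F.sym (F.identityˡ _))
  baᵏ (suc k) = begin
    b̄ F.∙ (ā F.∙ k times ā)                      ≈⟨ F.sym (F.assoc _ _ _) ⟩
    b̄ F.∙ ā F.∙ k times ā                        ≈⟨ F.∙-congʳ ba ⟩
    2 times ā F.∙ b̄ F.∙ k times ā                ≈⟨ F.assoc _ _ _ ⟩
    2 times ā F.∙ (b̄ F.∙ k times ā)              ≈⟨ F.∙-congˡ (baᵏ k) ⟩
    2 times ā F.∙ ((k * 2) times ā F.∙ b̄)        ≈⟨ F.sym (F.assoc _ _ _) ⟩
    2 times ā F.∙ (k * 2) times ā F.∙ b̄          ≈⟨ F.∙-congʳ (F.sym (×-homo-+ ā 2 (k * 2))) ⟩
    (suc k * 2) times ā F.∙ b̄                    ∎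

  bʲaᵏ : ∀ j k → j times b̄ F.∙ k times ā F.≈ (2 ^ j * k) times ā F.∙ j times b̄
  bʲaᵏ zero    k = begin
    F.ε F.∙ k times ā               ≈⟨ F.identityˡ _ ⟩
    k times ā                       ≈⟨ ×-congˡ (≡.sym (ℕₚ.+-identityʳ k)) ⟩
    (k + 0) times ā                 ≈⟨ F.sym (F.identityʳ _) ⟩
    (k + 0) times ā F.∙ F.ε         ∎
  bʲaᵏ (suc j) k = begin
    b̄ F.∙ j times b̄ F.∙ k times ā                      ≈⟨ F.assoc _ _ _ ⟩
    b̄ F.∙ (j times b̄ F.∙ k times ā)                    ≈⟨ F.∙-congˡ (bʲaᵏ j k) ⟩
    b̄ F.∙ ((2 ^ j * k) times ā F.∙ j times b̄)          ≈⟨ F.sym (F.assoc _ _ _) ⟩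
    b̄ F.∙ (2 ^ j * k) times ā F.∙ j times b̄            ≈⟨ F.∙-congʳ (baᵏ (2 ^ j * k)) ⟩
    (2 ^ j * k * 2) times ā F.∙ b̄ F.∙ j times b̄        ≈⟨ F.assoc _ _ _ ⟩
    (2 ^ j * k * 2) times ā F.∙ (b̄ F.∙ j times b̄)      ≈⟨ F.∙-congʳ (×-congˡ
      (≡.trans (ℕₚ.*-comm (2 ^ j * k) 2) (≡.sym (ℕₚ.*-assoc 2 (2 ^ j) k)))) ⟩
    (2 ^ suc j * k) times ā F.∙ suc j times b̄          ∎

  word-homo : ∀ x y → word (x ∙ᶠ y) F.≈ word x F.∙ word y
  word-homo (i , j) (k , l) = F.sym (begin
    aⁱ F.∙ bʲ F.∙ (aᵏ F.∙ bˡ)                     ≈⟨ F.assoc _ _ _ ⟩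
    aⁱ F.∙ (bʲ F.∙ (aᵏ F.∙ bˡ))                   ≈⟨ F.∙-congˡ (F.sym (F.assoc _ _ _)) ⟩
    aⁱ F.∙ (bʲ F.∙ aᵏ F.∙ bˡ)                     ≈⟨ F.∙-congˡ (F.∙-congʳ (bʲaᵏ (toℕ j) (toℕ k))) ⟩
    aⁱ F.∙ (e times ā F.∙ bʲ F.∙ bˡ)              ≈⟨ F.∙-congˡ (F.assoc _ _ _) ⟩
    aⁱ F.∙ (e times ā F.∙ (bʲ F.∙ bˡ))            ≈⟨ F.sym (F.assoc _ _ _) ⟩
    aⁱ F.∙ e times ā F.∙ (bʲ F.∙ bˡ)              ≈⟨ F.∙-cong
      (F.sym (×-homo-+ ā (toℕ i) e)) (F.sym (×-homo-+ b̄ (toℕ j) (toℕ l))) ⟩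
    (toℕ i + e) times ā F.∙ (toℕ j + toℕ l) times b̄
      ≈⟨ F.∙-cong (F.sym (reduce {ā} {5} (relation a⁵≈1) (toℕ i + e)))
                  (F.sym (reduce {b̄} {4} (relation b⁴≈1) (toℕ j + toℕ l))) ⟩
    word ((i , j) ∙ᶠ (k , l))                     ∎)
    where
    aⁱ = toℕ i times ā
    bʲ = toℕ j times b̄
    aᵏ = toℕ k times ā
    bˡ = toℕ l times b̄
    e  = 2 ^ toℕ j * toℕ k

  wordHom : Hom F₂₀ F₂₀-presented
  wordHom = mkHom word (λ { ≡.refl → F.refl }) word-homo

  generator : Generator → F₂₀-elem
  generator 𝐚 = 1 mod 5 , 0 mod 4
  generator 𝐛 = 0 mod 5 , 1 mod 4

  value : Word → F₂₀-elem
  value = Presentation.evaluate Generator F₂₀-relation F₂₀ generator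

  value-cong : ∀ {u v} → u F.≈ v → value u ≡ value v
  value-cong = Presentation.evaluate-cong Generator F₂₀-relation F₂₀ generator
    λ { a⁵≈1 → ≡.refl ; b⁴≈1 → ≡.refl ; bab⁻¹≈a² → ≡.refl }

  value-word : ∀ x → value (word x) ≡ x
  value-word = from-yes (all-pairs? λ x → value (word x) ≟ x)

  word-value : ∀ w → word (value w) F.≈ w
  word-value (gen 𝐚) = F.trans (F.identityʳ _) (F.identityʳ _)
  word-value (gen 𝐛) = F.trans (F.identityˡ _) (F.identityʳ _)
  word-value (u · v) = F.trans (word-homo (value u) (value v))
                               (F.∙-cong (word-value u) (word-value v))
  word-value 1ʷ      = F.identityˡ _
  word-value (u ⁻)   = F.trans (Hom.⁻¹-homo wordHom (value u)) (F.⁻¹-cong (word-value u))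

-- The isomorphism (i , j) ↦ aⁱbʲ.
F₂₀≅presented : F₂₀ ≅ F₂₀-presented
F₂₀≅presented = record
  { to    = word
  ; isIso = record
    { isGroupMonomorphism = record
      { isGroupHomomorphism = Hom.isGroupHomomorphism wordHom
      ; injective = λ {x} {y} p → ≡.trans (≡.sym (value-word x))
          (≡.trans (value-cong p) (value-word y))
      }
    ; surjective = λ w → value w , λ { ≡.refl → word-value w }
    }
  }

S₁₄-list : List F₂₀-elem
S₁₄-list =
    (# 0 , # 1) ∷ (# 0 , # 2) ∷ (# 0 , # 3)
  ∷ (# 1 , # 0) ∷ (# 1 , # 1) ∷ (# 1 , # 2) ∷ (# 1 , # 3)
  ∷ (# 2 , # 0) ∷ (# 2 , # 3)
  ∷ (# 3 , # 0) ∷ (# 3 , # 1) ∷ (# 3 , # 3)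
  ∷ (# 4 , # 0) ∷ (# 4 , # 1) ∷ []

open DecMembership _≟_ using (_∈?_) renaming (_∈_ to _∈ᴸ_)

S₁₄ : ConnectionSet F₂₀ 0ℓ
S₁₄ = record
  { Mem            = _∈ᴸ S₁₄-list
  ; resp           = λ { ≡.refl p → p }
  ; inverse-closed = λ {x} → from-yes (all-pairs? λ y →
      (y ∈? S₁₄-list) →-dec ((y ⁻¹ᶠ) ∈? S₁₄-list)) x
  ; ε∉             = from-no (εᶠ ∈? S₁₄-list)
  }

X₁₄ : Graph 0ℓ 0ℓ 0ℓ
X₁₄ = Cay F₂₀ S₁₄

A : Group 0ℓ 0ℓ
A = ⌊ Aut X₁₄ ⌋

A-action : Action A (Graph.V X₁₄)
A-action = inclusion (Aut X₁₄)

S₆ : Group 0ℓ 0ℓ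
S₆ = Sym (≡.setoid (Fin 6))

W : ℕ → Group 0ℓ 0ℓ
W d = S₆ ≀S d

W-action : (d : ℕ) → Action (W d) (Graph.V (Hamming d 6))
W-action = productAction idᴴ

Γ : ℕ → Graph 0ℓ 0ℓ 0ℓ
Γ d = X₁₄ □ Hamming d 6

Γ-action : (d : ℕ) → Action (A ×ᴳ W d) (Graph.V (Γ d))
Γ-action d = A-action ×ᴬ W-action d

R : (d : ℕ) (H : Subgroup (W d)) → Hom A (N/ H) → Subgroup (A ×ᴳ W d)
R d H φ = cosetGraph {A} {W d} H φ

{-# OPTIONS --safe #-}
-- An edge of X₁₄ has two non-adjacent common neighbours, whereas the common
-- neighbours of an edge of H(d,6) lie on a line and so are pairwise adjacent, also in
-- Γ_d.  Hence automorphisms of Γ_d preserve the two kinds of edges, and since both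
-- factors are connected they split as (a , c).  An automorphism c of H(d,6) induces a
-- permutation σ of the directions of edges that is the same at every vertex (compare
-- the opposite sides of squares), and then coordinate σ(i) of c(u) depends on uᵢ only.
-- That the stabilizer of a vertex of X₁₄ is trivial is a finite search.
--
-- If K ≤ A × W is regular, take H = {c : (1,c) ∈ K}.  As A acts freely, any element of
-- K that sends (x₀,y₀) to (a x₀,y₀) has the form (a,c), and cH is φ(a).
--
-- For a regular abelian group of automorphisms the first coordinates would be
-- commuting right translations by all elements of F₂₀.
module Submission where

open import Algebra.Bundles using (AbelianGroup)
open import Algebra.Construct.DirectProduct using () renaming (group to _×ᴳ_)
open import Data.Nat.Base using (ℕ)
open import Data.Product using (Σ-syntax; _×_)
open import Function.Bundles using (_⇔_)
open import Level using (Level)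
open import Relation.Nullary.Negation using (¬_)
open import Relation.Unary using (_⊆_; _≐_)
open import Defs

open import Algebra.Bundles using (Group)
import Algebra.Properties.Group as GroupProperties
open import Data.Bool.Base using (Bool)
import Data.Bool.Properties as Bool
open import Data.Fin.Base using (Fin; zero; suc)
open import Data.Fin using (#_)
open import Data.Fin.Properties using (any?) renaming (_≟_ to _≟ᶠ_)
open import Data.List.Base using (List; []; _∷_; map; _ʳ++_)
import Data.List.Membership.DecPropositional as DecMembership
open import Data.List.Relation.Unary.All as All using (All)
import Data.List.Relation.Unary.All.Properties as All
open import Data.Nat.Base using (zero; suc)
open import Data.Product using (∃; ∃₂; _,_; proj₁; proj₂)
import Data.Product.Base as Product
open import Data.Product.Function.NonDependent.Setoid using (_×-inverse_)
open import Data.Sum.Base as Sum using (_⊎_; inj₁; inj₂)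
open import Data.Unit.Base using (⊤; tt)
open import Data.Vec.Functional using (Vector; updateAt; head; tail) renaming (_∷_ to _∷ᵛ_)
open import Data.Vec.Functional.Properties using (updateAt-updates; updateAt-minimal)
open import Function.Base using (_∘_; const; case_of_)
open import Function.Bundles using (Inverse; Injection; Equivalence; mk⇔)
open import Function.Construct.Composition as FC using (_⇔-∘_)
import Function.Construct.Symmetry as FS
open import Function.Properties.Inverse using (Inverse⇒Injection)
open import Level using (0ℓ)
open import Relation.Binary.Bundles using (Setoid)
open import Relation.Binary.PropositionalEquality as ≡ using (_≡_; _≢_; _≗_)
import Relation.Binary.Reasoning.Setoid as SetoidReasoning
open import Relation.Nullary.Decidable
  using (Dec; yes; no; does; does-⇔; from-yes; map′; decidable-stable; ¬?; _×-dec_; _→-dec_)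
open import Relation.Nullary.Negation using (contradiction)
open import Relation.Unary using (Pred)

-- Kernels and quotient groups

module _ {G Q : Group 0ℓ 0ℓ} (f : Hom G Q) where
  private
    module G = Group G
    module Q = Group Q
    module f = Hom f
    module Qₚ = GroupProperties Q

  kernel : NormalSubgroup G
  kernel = record
    { subgroup = record
      { Mem       = λ x → f ⟨$⟩ x Q.≈ Q.ε
      ; resp      = λ x≈y p → Q.trans (f.⟦⟧-cong (G.sym x≈y)) p
      ; ε-closed  = f.ε-homo
      ; ∙-closed  = λ p q → Q.trans (f.homo _ _) (Q.trans (Q.∙-cong p q) (Q.identityˡ _))
      ; ⁻¹-closed = λ p → Q.trans (f.⁻¹-homo _) (Q.trans (Q.⁻¹-cong p) Qₚ.ε⁻¹≈ε)
      }
    ; normal = λ g p → Q.trans (f.homo _ _)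
        (Q.trans (Q.∙-cong (Q.trans (f.homo _ _) (Q.trans (Q.∙-congˡ p) (Q.identityʳ _))) (f.⁻¹-homo g))
          (Q.inverseʳ _))
    }

  first-isomorphism : (∀ y → ∃ λ x → f ⟨$⟩ x Q.≈ y) → G /ᴳ kernel ≅ Q
  first-isomorphism surjective = record
    { to    = f ⟨$⟩_
    ; isIso = record
      { isGroupMonomorphism = record
        { isGroupHomomorphism = Hom.isGroupHomomorphism (mkHom {G /ᴳ kernel} {Q} (f ⟨$⟩_) cong f.homo)
        ; injective = λ {x} {y} fx≈fy → Q.trans (f⁻¹-homo x y)
            (Q.trans (Q.∙-congˡ (Q.sym fx≈fy)) (Q.inverseˡ _))
        }
      ; surjective = λ y → proj₁ (surjective y) , λ z≈x → Q.trans (cong z≈x) (proj₂ (surjective y))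
      }
    }
    where
    f⁻¹-homo : ∀ x y → f ⟨$⟩ (x G.⁻¹ G.∙ y) Q.≈ (f ⟨$⟩ x) Q.⁻¹ Q.∙ (f ⟨$⟩ y)
    f⁻¹-homo x y = Q.trans (f.homo _ _) (Q.∙-congʳ (f.⁻¹-homo x))
    cong : ∀ {x y} → f ⟨$⟩ (x G.⁻¹ G.∙ y) Q.≈ Q.ε → f ⟨$⟩ x Q.≈ f ⟨$⟩ y
    cong {x} {y} p = Q.trans (Q.sym (Qₚ.⁻¹-involutive _))
      (Q.sym (Qₚ.inverseʳ-unique _ _ (Q.trans (Q.sym (f⁻¹-homo x y)) p)))

quotient≅ : {G A Q : Group 0ℓ 0ℓ} (f : Hom G A) → (∀ a → ∃ λ x → Group._≈_ A (f ⟨$⟩ x) a) →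
            A ≅ Q → Σ[ M ∈ NormalSubgroup G ] G /ᴳ M ≅ Q
quotient≅ {G} {A} {Q} f f-surjective A≅Q = kernel g , first-isomorphism g λ y →
  let a , a↦y = surjective y
      x , x↦a = f-surjective a
  in x , a↦y x↦a
  where
  open _≅_ A≅Q using (surjective; isGroupHomomorphism)
  g : Hom G Q
  g = record { isGroupHomomorphism = isGroupHomomorphism } ∘ᴴ f

-- Free and regular actions

module _ {G : Group 0ℓ 0ℓ} {X : Setoid 0ℓ 0ℓ} (ρ : Action G X) where
  private
    module G = Group G
    module X = Setoid X
    module ρ = Hom ρ
    module Gₚ = GroupProperties G

  free⇒injective : (∀ x {g} → act ρ g x X.≈ x → g G.≈ G.ε) →
                   ∀ {g h} x → act ρ g x X.≈ act ρ h x → g G.≈ h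
  free⇒injective free {g} {h} x gx≈hx = G.trans (G.sym (Gₚ.⁻¹-involutive g))
    (G.sym (Gₚ.inverseʳ-unique _ _ (free x (X.trans (act-∙ ρ (g G.⁻¹) h x)
      (X.trans (act-cong ρ (g G.⁻¹) (X.sym gx≈hx))
        (X.trans (X.sym (act-∙ ρ (g G.⁻¹) g x))
          (X.trans (ρ.⟦⟧-cong (G.inverseˡ g) x) (ρ.ε-homo x))))))))

  -- Semiregularity only makes `ρ ⟨$⟩ g` the identity permutation; faithfulness turns this into
  -- `g ≈ ε`.
  preimage-regular : Faithful ρ → (P : Subgroup (Sym X)) →
    Subgroup.Mem P ⊆ Subgroup.Mem (image ρ (whole G)) →
    IsRegular idᴴ P → IsRegular ρ (preimage ρ P)
  preimage-regular faithful P P⊆G (transitive , semiregular) = transitive′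
    , λ x {g} g∈P gx≈x → faithful g (semiregular x {ρ ⟨$⟩ g} g∈P gx≈x)
    where
    transitive′ : IsTransitive ρ (preimage ρ P)
    transitive′ x y with transitive x y
    ... | p , p∈P , px≈y with P⊆G {p} p∈P
    ...   | g , _ , g≈p = g , Subgroup.resp P {p} {ρ ⟨$⟩ g} (λ x → X.sym (g≈p x)) p∈P , X.trans (g≈p x) px≈y

  image-regular : (K : Subgroup G) → IsRegular ρ K → IsRegular idᴴ (image ρ K)
  image-regular K (transitive , semiregular) =
      (λ x y → let (g , g∈K , gx≈y) = transitive x y in ρ ⟨$⟩ g , (g , g∈K , λ _ → X.refl) , gx≈y)
    , λ x {p} (g , g∈K , g≈p) px≈x y → X.trans (X.sym (g≈p y))
        (X.trans (ρ.⟦⟧-cong (semiregular x g∈K (X.trans (g≈p x) px≈x)) y) (ρ.ε-homo y))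

  image-preimage : (P : Subgroup (Sym X)) → Subgroup.Mem P ⊆ Subgroup.Mem (image ρ (whole G)) →
    Subgroup.Mem P ≐ Subgroup.Mem (image ρ (preimage ρ P))
  image-preimage P P⊆G =
      (λ {p} p∈P → let (g , _ , g≈p) = P⊆G {p} p∈P in
        g , Subgroup.resp P {p} {ρ ⟨$⟩ g} (λ x → X.sym (g≈p x)) p∈P , g≈p)
    , λ {p} (g , g∈P , g≈p) → Subgroup.resp P {ρ ⟨$⟩ g} {p} g≈p g∈P

  regular-resp : (K L : Subgroup G) → Subgroup.Mem K ≐ Subgroup.Mem L → IsRegular ρ K → IsRegular ρ L
  regular-resp K L (K⊆L , L⊆K) (transitive , semiregular) =
      (λ x y → let (g , g∈K , gx≈y) = transitive x y in g , K⊆L g∈K , gx≈y)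
    , λ x g∈L → semiregular x (L⊆K g∈L)

  image-mono : (K L : Subgroup G) → Subgroup.Mem K ⊆ Subgroup.Mem L →
               Subgroup.Mem (image ρ K) ⊆ Subgroup.Mem (image ρ L)
  image-mono K L K⊆L (g , g∈K , g≈p) = g , K⊆L g∈K , g≈p

-- Coset graphs and regular subgroups of a direct product

module _ {A W : Group 0ℓ 0ℓ} (H : Subgroup W) (φ : Hom A (N/ H)) where
  private
    module A = Group A
    module W = Group W
    module H = Subgroup H
    module R = Subgroup (cosetGraph {A} {W} H φ)
    module Wₚ = GroupProperties W

  cosetGraph-coset : ∀ a {h} → H.Mem h → R.Mem (a , proj₁ (φ ⟨$⟩ a) W.∙ h)
  cosetGraph-coset a {h} p =
      Subgroup.∙-closed (normalizer H) (proj₂ (φ ⟨$⟩ a)) (member⇒normalizes H p)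
    , H.resp (W.sym (W.trans (W.∙-congʳ (Wₚ.⁻¹-anti-homo-∙ c h)) (Wₚ.//-rightDividesˡ c (h W.⁻¹))))
        (H.⁻¹-closed p)
    where c = proj₁ (φ ⟨$⟩ a)

  cosetGraph-proj₁ : Hom ⌊ cosetGraph {A} {W} H φ ⌋ A
  cosetGraph-proj₁ = mkHom (λ r → proj₁ (proj₁ r)) proj₁ (λ _ _ → A.refl)

  cosetGraph-proj₁-surjective : ∀ a → ∃ λ r → cosetGraph-proj₁ ⟨$⟩ r A.≈ a
  cosetGraph-proj₁-surjective a = (_ , cosetGraph-coset a H.ε-closed) , A.refl

module _ {A W : Group 0ℓ 0ℓ} {X Y : Setoid 0ℓ 0ℓ} (ρ : Action A X) (τ : Action W Y) where
  private
    module A = Group A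
    module W = Group W
    module X = Setoid X
    module Y = Setoid Y
    module ρ = Hom ρ
    G = A ×ᴳ W
    module G = Group G
    module Wₚ = GroupProperties W

  module RegularSubgroup (free : ∀ x {a} → act ρ a x X.≈ x → a A.≈ A.ε)
                         (x₀ : X.Carrier) (y₀ : Y.Carrier)
                         (K : Subgroup G) (regular : IsRegular (ρ ×ᴬ τ) K) where
    private
      module K = Subgroup K
      transitive  = proj₁ regular
      semiregular = proj₂ regular

    sectionʷ : Hom W G
    sectionʷ = mkHom (λ c → A.ε , c) (λ p → A.refl , p) (λ _ _ → A.sym (A.identityˡ _) , W.refl)

    H : Subgroup W
    H = preimage sectionʷ K

    private module H = Subgroup H

    H-regular : IsRegular τ H
    H-regular = transitive′
      , λ y {c} c∈K cy≈y → proj₂ (semiregular (x₀ , y) c∈K (ρ.ε-homo x₀ , cy≈y))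
      where
      transitive′ : IsTransitive τ H
      transitive′ y z with transitive (x₀ , y) (x₀ , z)
      ... | (a , c) , ac∈K , ax≈x , cy≈z = c , K.resp (free x₀ ax≈x , W.refl) ac∈K , cy≈z

    lift : ∀ a → ∃ λ c → K.Mem (a , c)
    lift a with transitive (x₀ , y₀) (act ρ a x₀ , y₀)
    ... | (b , c) , bc∈K , bx≈ax , _ = c , K.resp (free⇒injective ρ free x₀ bx≈ax , W.refl) bc∈K

    -- The inverse of `(a , c)` times `(b , e)` has trivial first component. This makes `φ` well
    -- defined and multiplicative and gives one inclusion of `K≐cosetGraph`.
    same-coset : ∀ {a b c e} → a A.≈ b → K.Mem (a , c) → K.Mem (b , e) → H.Mem (c W.⁻¹ W.∙ e)
    same-coset a≈b p q = K.resp (A.trans (A.∙-congˡ (A.sym a≈b)) (A.inverseˡ _) , W.refl)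
      (K.∙-closed (K.⁻¹-closed p) q)

    -- Conjugation by `(a , c)` maps `(ε , h)` to `(ε , c ∙ h ∙ c ⁻¹)` and preserves `K`.
    normalizes : ∀ {a c} → K.Mem (a , c) → Subgroup.Mem (normalizer H) c
    normalizes {a} {c} p h = mk⇔
      (λ q → K.resp (conj-ε , W.refl) (Equivalence.to (member⇒normalizes K p (A.ε , h)) q))
      (λ q → Equivalence.from (member⇒normalizes K p (A.ε , h)) (K.resp (A.sym conj-ε , W.refl) q))
      where
      conj-ε : a A.∙ A.ε A.∙ a A.⁻¹ A.≈ A.ε
      conj-ε = A.trans (A.∙-congʳ (A.identityʳ a)) (A.inverseʳ a)

    φ : Hom A (N/ H)
    φ = mkHom {A} {N/ H} (λ a → proj₁ (lift a) , normalizes (proj₂ (lift a)))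
      (λ {a} {b} a≈b → same-coset a≈b (proj₂ (lift a)) (proj₂ (lift b)))
      (λ a b → same-coset A.refl (proj₂ (lift (a A.∙ b))) (K.∙-closed (proj₂ (lift a)) (proj₂ (lift b))))

    K≐cosetGraph : K.Mem ≐ Subgroup.Mem (cosetGraph {A} {W} H φ)
    K≐cosetGraph = (λ {(a , c)} p → normalizes p , same-coset A.refl p (proj₂ (lift a)))
      -- With `e` the chosen lift of `a`, the pair `(a , c)` is `(a , e)` times the inverse of
      -- `(ε , c ⁻¹ ∙ e)`, both in `K`.
      , λ {(a , c)} (_ , p) → K.resp (A.trans (A.∙-congˡ ε⁻¹≈ε) (A.identityʳ a) , cancel c _)
          (K.∙-closed (proj₂ (lift a)) (K.⁻¹-closed p))
      where
      open GroupProperties A using (ε⁻¹≈ε)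
      cancel : ∀ c e → e W.∙ (c W.⁻¹ W.∙ e) W.⁻¹ W.≈ c
      cancel c e = W.trans (W.∙-congˡ (Wₚ.⁻¹-anti-homo-\\ c e)) (Wₚ.\\-leftDividesˡ e c)

  module _ (H : Subgroup W) (φ : Hom A (N/ H)) where
    private
      module H = Subgroup H
      module Q = Group (N/ H)
      module φ = Hom φ

    cosetGraph-regular : (∀ x y → ∃ λ a → act ρ a x X.≈ y) →
                         (∀ x {a} → act ρ a x X.≈ x → a A.≈ A.ε) →
                         IsRegular τ H → IsRegular (ρ ×ᴬ τ) (cosetGraph H φ)
    cosetGraph-regular transitive free (H-transitive , H-semiregular) = transitive′ , semiregular
      where
      transitive′ : IsTransitive (ρ ×ᴬ τ) (cosetGraph H φ)
      transitive′ (x , y) (x′ , y′) with transitive x x′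
      -- The first coordinate determines `a`; a representative `c` of the coset of `a` is then
      -- corrected by the `h` in `H` that sends `y` to the preimage of `y′` under `c`.
      ... | a , ax≈x′ with H-transitive y (act τ (proj₁ (φ ⟨$⟩ a) W.⁻¹) y′)
      ...   | h , h∈H , hy≈ = (a , c W.∙ h) , cosetGraph-coset H φ a h∈H
        , ax≈x′ , Y.trans (act-∙ τ c h y) (Y.trans (act-cong τ c hy≈) (act-⁻¹ τ c y′))
        where c = proj₁ (φ ⟨$⟩ a)

      semiregular : IsSemiregular (ρ ×ᴬ τ) (cosetGraph H φ)
      semiregular (x , y) {a , c} (c∈N , c∼φa) (ax≈x , cy≈y) = a≈ε , H-semiregular y c∈H cy≈y
        where
        a≈ε = free x ax≈x
        c⁻¹∈H : H.Mem (c W.⁻¹ W.∙ W.ε)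
        c⁻¹∈H = Q.trans {c , c∈N} {φ ⟨$⟩ a} {Q.ε} c∼φa
          (Q.trans {φ ⟨$⟩ a} {φ ⟨$⟩ A.ε} {Q.ε} (φ.⟦⟧-cong a≈ε) φ.ε-homo)
        c∈H : H.Mem c
        c∈H = H.resp (W.trans (Wₚ.⁻¹-anti-homo-\\ c W.ε) (W.trans (W.∙-congʳ Wₚ.ε⁻¹≈ε) (W.identityˡ c)))
          (H.⁻¹-closed c⁻¹∈H)

-- Semidirect decomposition of a coset graph

module _ {A W : Group 0ℓ 0ℓ} {Y : Setoid 0ℓ 0ℓ} (τ : Action W Y) (H : Subgroup W)
         (regular : IsRegular τ H) (φ : Hom A (N/ H)) (ω : Setoid.Carrier Y) where
  private
    module A = Group A
    module W = Group W
    module H = Subgroup H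
    module N = Subgroup (normalizer H)
    module Q = Group (N/ H)
    module φ = Hom φ
    module Wₚ = GroupProperties W
    RG = ⌊ cosetGraph {A} {W} H φ ⌋
    module R = Group RG
    open SetoidReasoning W.setoid

    -- A coset has only one representative that fixes `ω`, so this choice is multiplicative in the
    -- normalizer itself, not merely modulo `H`.
    representative : Hom A ⌊ normalizerStabilizer τ H regular ω ⌋
    representative = inverseHom (stabilizer≅quotient τ H regular ω) ∘ᴴ φ
    module n = Hom representative

    n : A.Carrier → W.Carrier
    n a = proj₁ (proj₁ (representative ⟨$⟩ a))

    n∈N : ∀ a → N.Mem (n a)
    n∈N a = proj₂ (proj₁ (representative ⟨$⟩ a))

    n∼φ : ∀ a → (n a , n∈N a) Q.≈ φ ⟨$⟩ a
    n∼φ a = proj₂ (_≅_.surjective (stabilizer≅quotient τ H regular ω) (φ ⟨$⟩ a))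
      {representative ⟨$⟩ a} W.refl

    S : Group 0ℓ 0ℓ
    S = ⌊ H ⌋ ⋊[ quotientEmbedding τ H regular ω ∘ᴴ φ ] A
    module S = Group S

    -- Factors `c` as `h ∙ n a` and keeps `h` and `a`. The factor `h` is in `H`, being the conjugate
    -- by `n a` of `n a ⁻¹ ∙ c`.
    split : R.Carrier → S.Carrier
    split ((a , c) , c∈N , c∼φa) = (c W.∙ n a W.⁻¹ , H.resp conj-n (Equivalence.to (n∈N a _) n⁻¹c∈H)) , a
      where
      n⁻¹c∈H : H.Mem (n a W.⁻¹ W.∙ c)
      n⁻¹c∈H = Q.trans {n a , n∈N a} {φ ⟨$⟩ a} {c , c∈N} (n∼φ a)
        (Q.sym {c , c∈N} {φ ⟨$⟩ a} c∼φa)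
      conj-n : n a W.∙ (n a W.⁻¹ W.∙ c) W.∙ n a W.⁻¹ W.≈ c W.∙ n a W.⁻¹
      conj-n = W.∙-congʳ (Wₚ.\\-leftDividesˡ (n a) c)

    split-homo : ∀ r s → split (r R.∙ s) S.≈ split r S.∙ split s
    split-homo ((a , c) , _) ((b , e) , _) = (begin
      c W.∙ e W.∙ n (a A.∙ b) W.⁻¹
        ≈⟨ W.∙-congˡ (W.⁻¹-cong (n.homo a b)) ⟩
      c W.∙ e W.∙ (n a W.∙ n b) W.⁻¹
        ≈⟨ W.∙-congˡ (Wₚ.⁻¹-anti-homo-∙ (n a) (n b)) ⟩
      c W.∙ e W.∙ (n b W.⁻¹ W.∙ n a W.⁻¹)
        ≈⟨ W.trans (W.sym (W.assoc _ _ _)) (W.∙-congʳ (W.assoc _ _ _)) ⟩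
      c W.∙ (e W.∙ n b W.⁻¹) W.∙ n a W.⁻¹
        -- Inserting `n a ⁻¹ ∙ n a` produces conjugation by `n a`, which is the action of `a` on `H`
        -- in the semidirect product.
        ≈⟨ W.∙-congʳ (W.∙-congʳ (W.sym (Wₚ.//-rightDividesˡ (n a) c))) ⟩
      c W.∙ n a W.⁻¹ W.∙ n a W.∙ (e W.∙ n b W.⁻¹) W.∙ n a W.⁻¹
        ≈⟨ W.trans (W.∙-congʳ (W.assoc _ _ _)) (W.assoc _ _ _) ⟩
      c W.∙ n a W.⁻¹ W.∙ (n a W.∙ (e W.∙ n b W.⁻¹) W.∙ n a W.⁻¹)   ∎) , A.refl

    split-cong : ∀ {r s} → r R.≈ s → split r S.≈ split s
    split-cong (a≈b , c≈e) = W.∙-cong c≈e (W.⁻¹-cong (n.⟦⟧-cong a≈b)) , a≈b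

  cosetGraph≅semidirect : RG ≅ S
  cosetGraph≅semidirect = record
    { to    = split
    ; isIso = record
      { isGroupMonomorphism = record
        { isGroupHomomorphism = Hom.isGroupHomomorphism (mkHom {RG} {S} split
            (λ {r} {s} → split-cong {r} {s}) split-homo)
        ; injective = λ {((a , c) , _)} {((b , e) , _)} (p , a≈b) → a≈b
            , Wₚ.∙-cancelʳ (n b W.⁻¹) c e (W.trans (W.∙-congˡ (W.⁻¹-cong (n.⟦⟧-cong (A.sym a≈b)))) p)
        }
      ; surjective = surjective
      }
    }
    where
    surjective : ∀ s → ∃ λ r → ∀ {t} → t R.≈ r → split t S.≈ s
    surjective ((h , h∈H) , a) = r , λ {t} t≈r → W.trans (proj₁ (split-cong {t} {r} t≈r))
        (Wₚ.//-rightDividesʳ (n a) h) , proj₁ t≈r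
      where
      hn∈N = N.∙-closed (member⇒normalizes H h∈H) (n∈N a)
      hn∼n : (h W.∙ n a , hn∈N) Q.≈ (n a , n∈N a)
      hn∼n = H.resp (W.∙-cong (W.sym (Wₚ.⁻¹-anti-homo-∙ h (n a))) (Wₚ.⁻¹-involutive (n a)))
        (Equivalence.to (N.⁻¹-closed (n∈N a) _) (H.⁻¹-closed h∈H))
      r : R.Carrier
      r = (a , h W.∙ n a) , hn∈N , Q.trans {_ , hn∈N} {n a , n∈N a} {φ ⟨$⟩ a} hn∼n (n∼φ a)

-- Graphs

module _ {c ℓ s} (G : Group c ℓ) (S : ConnectionSet G s) where
  private
    open module G = Group G
    open GroupProperties G
    open Graph (Cay G S) using (_~_)
    module S = ConnectionSet S

    difference-translate : ∀ g x y → (y ∙ g) ∙ (x ∙ g) ⁻¹ ≈ y ∙ x ⁻¹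
    difference-translate g x y = trans (∙-congˡ (⁻¹-anti-homo-∙ x g))
      (trans (assoc y g _) (∙-congˡ (trans (sym (assoc g (g ⁻¹) (x ⁻¹)))
        (trans (∙-congʳ (inverseʳ g)) (identityˡ _)))))

  -- Adjacency depends on `y ∙ x ⁻¹` only, and the factors `g` cancel in it.
  translation-preserves : ∀ g x y → x ~ y ⇔ (x ∙ g) ~ (y ∙ g)
  translation-preserves g x y = mk⇔
    (S.resp (sym (difference-translate g x y))) (S.resp (difference-translate g x y))

CommonNeighbour : ∀ {c ℓ r} (Γ : Graph c ℓ r) (let open Graph Γ) → Vertex → Vertex → Vertex → Set r
CommonNeighbour Γ x y z = x ~ z × z ~ y
  where open Graph Γ

-- The invariant that tells the edges coming from `X₁₄` from those coming from the Hamming graph.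
Spread : ∀ {c ℓ r} (Γ : Graph c ℓ r) (let open Graph Γ) → Vertex → Vertex → Set _
Spread Γ x y = ∃₂ λ z w → CommonNeighbour Γ x y z × CommonNeighbour Γ x y w × ¬ z ≈ w × ¬ z ~ w
  where open Graph Γ

module _ (Γ : Graph 0ℓ 0ℓ 0ℓ) where
  open Graph Γ
  private
    module Aut = Subgroup (Aut Γ)

  Spread-preserved : ∀ f → Aut.Mem f → ∀ {x y} → Spread Γ x y → Spread Γ (Inverse.to f x) (Inverse.to f y)
  Spread-preserved f f∈Aut {x} {y} (z , w , (xz , zy) , (xw , wy) , z≉w , z≁w) =
    to z , to w , (edge xz , edge zy) , (edge xw , edge wy)
    , z≉w ∘ Injection.injective (Inverse⇒Injection f)
    , λ e → z≁w (Equivalence.from (f∈Aut z w) e)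
    where
    open Inverse f using (to)
    edge : ∀ {x y} → x ~ y → to x ~ to y
    edge {x} {y} = Equivalence.to (f∈Aut x y)

□-automorphism : (X Y : Graph 0ℓ 0ℓ 0ℓ) → ∀ f g → Subgroup.Mem (Aut X) f → Subgroup.Mem (Aut Y) g →
                 Subgroup.Mem (Aut (X □ Y)) (f ×-inverse g)
□-automorphism X Y f g f∈Aut g∈Aut (x , u) (y , v) = mk⇔
  (Sum.map (Product.map f.to-cong (Equivalence.to (g∈Aut u v)))
           (Product.map (Equivalence.to (f∈Aut x y)) g.to-cong))
  (Sum.map (Product.map f↣.injective (Equivalence.from (g∈Aut u v)))
           (Product.map (Equivalence.from (f∈Aut x y)) g↣.injective))
  where
  module f = Inverse f
  module g = Inverse g
  module f↣ = Injection (Inverse⇒Injection f)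
  module g↣ = Injection (Inverse⇒Injection g)

-- The graph X₁₄

open DecMembership _≟_ using (_∈?_)

private
  module A₁₄ = Group A
  module F = Group F₂₀
  module Fₚ = GroupProperties F₂₀

open Graph X₁₄ using () renaming (_~_ to _~ₓ_)

infix 4 _~ₓ?_
_~ₓ?_ : ∀ x y → Dec (x ~ₓ y)
x ~ₓ? y = (y ∙ᶠ x ⁻¹ᶠ) ∈? S₁₄-list

adjacent : F₂₀-elem → F₂₀-elem → Bool
adjacent x y = does (x ~ₓ? y)

-- A partial map, as a list of vertices paired with their prospective images.
Matching : Set
Matching = List (F₂₀-elem × F₂₀-elem)

Compatible : Matching → F₂₀-elem → F₂₀-elem → Set
Compatible m v w = All (λ (x , y) → adjacent x v ≡ adjacent y w) m

-- The images are chosen one vertex at a time, so that deciding this prunes every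
-- incompatible branch at once.
Rigid : Matching → List F₂₀-elem → Set
Rigid m []       = All (λ (x , y) → x ≡ y) m
Rigid m (v ∷ vs) = ∀ w → Compatible m v w → Rigid ((v , w) ∷ m) vs

rigid? : ∀ m vs → Dec (Rigid m vs)
rigid? m []       = All.all? (λ (x , y) → x ≟ y) m
rigid? m (v ∷ vs) = all-pairs? λ w →
  All.all? (λ (x , y) → adjacent x v Bool.≟ adjacent y w) m →-dec rigid? ((v , w) ∷ m) vs

-- The map `g` is one branch of the search: every quantified image is instantiated with `g v`. The
-- matching grows at its front, whence the reversed append.
rigid⇒fixed : (g : F₂₀-elem → F₂₀-elem) → (∀ x y → adjacent x y ≡ adjacent (g x) (g y)) →
              ∀ us vs → Rigid (map (λ x → x , g x) us) vs → All (λ x → x ≡ g x) (vs ʳ++ us)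
rigid⇒fixed g g-adj us []       r = All.map⁻ r
rigid⇒fixed g g-adj us (v ∷ vs) r =
  rigid⇒fixed g g-adj (v ∷ us) vs (r (g v) (All.map⁺ (All.universal (λ x → g-adj x v) us)))

-- An order of the vertices other than εᶠ that keeps the search tree small.
searchOrder : List F₂₀-elem
searchOrder =
    (# 4 , # 3) ∷ (# 1 , # 2) ∷ (# 2 , # 1) ∷ (# 1 , # 3) ∷ (# 2 , # 2)
  ∷ (# 0 , # 1) ∷ (# 4 , # 0) ∷ (# 3 , # 3) ∷ (# 4 , # 1) ∷ (# 0 , # 3)
  ∷ (# 4 , # 2) ∷ (# 1 , # 1) ∷ (# 2 , # 0) ∷ (# 0 , # 2) ∷ (# 2 , # 3)
  ∷ (# 1 , # 0) ∷ (# 3 , # 2) ∷ (# 3 , # 1) ∷ (# 3 , # 0) ∷ []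

abstract
  rigid-at-ε : Rigid ((εᶠ , εᶠ) ∷ []) searchOrder
  rigid-at-ε = from-yes (rigid? ((εᶠ , εᶠ) ∷ []) searchOrder)

fixes-ε⇒identity : (g : F₂₀-elem → F₂₀-elem) → g εᶠ ≡ εᶠ →
                   (∀ x y → x ~ₓ y ⇔ g x ~ₓ g y) → ∀ x → x ≡ g x
fixes-ε⇒identity g gε≡ε g-pres x = All.lookup
  (rigid⇒fixed g (λ x y → does-⇔ (g-pres x y) (x ~ₓ? y) (g x ~ₓ? g y)) (εᶠ ∷ []) searchOrder
    (≡.subst (λ y → Rigid ((εᶠ , y) ∷ []) searchOrder) (≡.sym gε≡ε) rigid-at-ε))
  (from-yes (all-pairs? λ x → x ∈? (searchOrder ʳ++ (εᶠ ∷ []))) x)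

-- Following `f` by the right translation by the inverse of `f(εᶠ)` gives a map that fixes `εᶠ` and
-- preserves adjacency both ways, hence the identity.
automorphism-is-translation : ((f , _) : A₁₄.Carrier) → ∀ x → Inverse.to f x ≡ x ∙ᶠ Inverse.to f εᶠ
automorphism-is-translation (f , f∈Aut) x = ≡.trans
  (≡.sym (Fₚ.//-rightDividesˡ fε (f.to x)))
  (≡.cong (_∙ᶠ fε) (≡.sym (fixes-ε⇒identity (λ y → f.to y ∙ᶠ fε ⁻¹ᶠ) (F.inverseʳ fε)
    (λ y z → translation-preserves F₂₀ S₁₄ (fε ⁻¹ᶠ) (f.to y) (f.to z) ⇔-∘ f∈Aut y z) x)))
  where
  module f = Inverse f
  fε = f.to εᶠ

A-free : ∀ x {f : A₁₄.Carrier} → act A-action f x ≡ x → f A₁₄.≈ A₁₄.ε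
A-free x {f} fx≡x y = ≡.trans (automorphism-is-translation f y)
  (≡.trans (≡.cong (y ∙ᶠ_) (Fₚ.identityʳ-unique x _
    (≡.trans (≡.sym (automorphism-is-translation f x)) fx≡x))) (F.identityʳ y))

rightTranslation : F₂₀-elem → A₁₄.Carrier
rightTranslation g =
  mkPermutation (≡.setoid F₂₀-elem) (_∙ᶠ g) (_∙ᶠ g ⁻¹ᶠ) (≡.cong _) (≡.cong _)
    (Fₚ.//-rightDividesˡ g) (Fₚ.//-rightDividesʳ g)
  , translation-preserves F₂₀ S₁₄ g

A-transitive : ∀ x y → ∃ λ f → act A-action f x ≡ y
A-transitive x y = rightTranslation (x ⁻¹ᶠ ∙ᶠ y) , Fₚ.\\-leftDividesˡ x y

-- f ∘ g is the right translation by g(1)f(1), whence the inverse.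
A≅F₂₀ : A ≅ F₂₀
A≅F₂₀ = record
  { to    = λ f → act A-action f εᶠ ⁻¹ᶠ
  ; isIso = record
    { isGroupMonomorphism = record
      { isGroupHomomorphism = Hom.isGroupHomomorphism (mkHom {A} {F₂₀} _
          (λ f≈g → ≡.cong _⁻¹ᶠ (f≈g εᶠ))
          (λ f g → ≡.trans
            (≡.cong _⁻¹ᶠ (automorphism-is-translation f (act A-action g εᶠ)))
            (Fₚ.⁻¹-anti-homo-∙ (act A-action g εᶠ) (act A-action f εᶠ))))
      ; injective = λ {f} {g} fε≡gε x → ≡.trans (automorphism-is-translation f x)
          (≡.trans (≡.cong (x ∙ᶠ_) (Fₚ.⁻¹-injective fε≡gε)) (≡.sym (automorphism-is-translation g x)))
      }
    ; surjective = λ x → rightTranslation (x ⁻¹ᶠ) , λ f≈ → ≡.trans (≡.cong _⁻¹ᶠ (f≈ εᶠ))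
        (≡.trans (≡.cong _⁻¹ᶠ (F.identityˡ (x ⁻¹ᶠ))) (Fₚ.⁻¹-involutive x))
    }
  }

any-pairs? : {P : Pred F₂₀-elem 0ℓ} → (∀ x → Dec (P x)) → Dec (∃ P)
any-pairs? P? = map′ (λ (i , j , p) → (i , j) , p) (λ ((i , j) , p) → i , j , p)
  (any? λ i → any? λ j → P? (i , j))

commonNeighbour? : ∀ x y z → Dec (CommonNeighbour X₁₄ x y z)
commonNeighbour? x y z = (x ~ₓ? z) ×-dec (z ~ₓ? y)

abstract
  -- Provides connectedness of `X₁₄`, with walks of length two.
  X₁₄-common : ∀ x y → ∃ (CommonNeighbour X₁₄ x y)
  X₁₄-common = from-yes (all-pairs? λ x → all-pairs? λ y → any-pairs? (commonNeighbour? x y))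

  X₁₄-spread-ε : ∀ y → εᶠ ~ₓ y → Spread X₁₄ εᶠ y
  X₁₄-spread-ε = from-yes (all-pairs? λ y → (εᶠ ~ₓ? y) →-dec any-pairs? λ z →
    -- The reordering lets the conditions on `z` alone be decided outside the inner search for `w`.
    map′ (λ (p , w , q) → w , p , q) (λ (w , p , q) → p , w , q)
      (commonNeighbour? εᶠ y z ×-dec any-pairs? λ w →
        commonNeighbour? εᶠ y w ×-dec ¬? (z ≟ w) ×-dec ¬? (z ~ₓ? w)))

-- Right translation by `x` carries the edge from `εᶠ` to `y ∙ᶠ x ⁻¹ᶠ` onto the given one, so edges
-- at `εᶠ` suffice.
X₁₄-spread : ∀ x y → x ~ₓ y → Spread X₁₄ x y
X₁₄-spread x y x~y = ≡.subst₂ (Spread X₁₄) (F.identityˡ x) (Fₚ.//-rightDividesˡ x y)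
  (translate εᶠ (y ∙ᶠ x ⁻¹ᶠ) (X₁₄-spread-ε (y ∙ᶠ x ⁻¹ᶠ) (Equivalence.from (pres εᶠ (y ∙ᶠ x ⁻¹ᶠ))
    (≡.subst₂ _~ₓ_ (≡.sym (F.identityˡ x)) (≡.sym (Fₚ.//-rightDividesˡ x y)) x~y))))
  where
  pres = translation-preserves F₂₀ S₁₄ x
  to : ∀ {u v} → u ~ₓ v → (u ∙ᶠ x) ~ₓ (v ∙ᶠ x)
  to {u} {v} = Equivalence.to (pres u v)
  translate : ∀ u v → Spread X₁₄ u v → Spread X₁₄ (u ∙ᶠ x) (v ∙ᶠ x)
  translate u v (z , w , (uz , zv) , (uw , wv) , z≢w , z≁w) =
    z ∙ᶠ x , w ∙ᶠ x , (to {u} {z} uz , to {z} {v} zv) , (to {u} {w} uw , to {w} {v} wv)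
    , (λ zx≡wx → z≢w (Fₚ.∙-cancelʳ x z w zx≡wx)) , λ e → z≁w (Equivalence.from (pres z w) e)

-- Hamming graphs

infix 4 _~[_]_
_~[_]_ : ∀ {d} {B : Set} → Vector B d → Fin d → Vector B d → Set
u ~[ i ] v = u i ≢ v i × (∀ j → j ≢ i → u j ≡ v j)

module _ {d q : ℕ} where
  private variable
    u u′ v v′ w z : Vector (Fin q) d
    i j k l : Fin d

  ~[]-sym : u ~[ i ] v → v ~[ i ] u
  ~[]-sym (ui≢vi , agree) = ui≢vi ∘ ≡.sym , λ j j≢i → ≡.sym (agree j j≢i)

  ~[]-resp : u ≗ u′ → v ≗ v′ → u ~[ i ] v → u′ ~[ i ] v′
  ~[]-resp {i = i} p q (ui≢vi , agree) =
      (λ e → ui≢vi (≡.trans (p i) (≡.trans e (≡.sym (q i)))))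
    , λ j j≢i → ≡.trans (≡.sym (p j)) (≡.trans (agree j j≢i) (q j))

  differ⇒direction : u ~[ i ] v → u j ≢ v j → j ≡ i
  differ⇒direction {i = i} {j = j} (_ , agree) uj≢vj =
    decidable-stable (j ≟ᶠ i) (λ j≢i → uj≢vj (agree j j≢i))

  direction-unique : u ~[ i ] v → u ~[ j ] v → i ≡ j
  direction-unique (ui≢vi , _) e = differ⇒direction e ui≢vi

  ≗⇒¬~[] : u ≗ v → ¬ u ~[ i ] v
  ≗⇒¬~[] {i = i} u≗v (ui≢vi , _) = ui≢vi (u≗v i)

  -- If `j` were not `i`, the third side would have to change coordinate `i`, so `k` would be `i`,
  -- and `w` would agree with `v`, hence with `u`, at `j`.
  triangle : u ~[ i ] v → u ~[ j ] w → w ~[ k ] v → j ≡ i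
  triangle {u} {i} {v} {j} {w} {k} (ui≢vi , uv) (uj≢wj , uw) (wk≢vk , wv) =
    decidable-stable (j ≟ᶠ i) λ j≢i →
      let i≡k = decidable-stable (i ≟ᶠ k) λ i≢k →
                  ui≢vi (≡.trans (uw i (j≢i ∘ ≡.sym)) (wv i i≢k))
      in uj≢wj (≡.trans (uv j j≢i) (≡.sym (wv j λ j≡k → j≢i (≡.trans j≡k (≡.sym i≡k)))))

  two-steps : u ~[ i ] v → u ~[ i ] w → v ≗ w ⊎ v ~[ i ] w
  two-steps {u} {i} {v} {w} (_ , uv) (_ , uw) with v i ≟ᶠ w i
  ... | no  vi≢wi = inj₂ (vi≢wi , λ j j≢i → ≡.trans (≡.sym (uv j j≢i)) (uw j j≢i))
  ... | yes vi≡wi = inj₁ λ j → case j ≟ᶠ i of λ where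
    (yes ≡.refl) → vi≡wi
    (no  j≢i)    → ≡.trans (≡.sym (uv j j≢i)) (uw j j≢i)

  line : ∀ {t} → u i ≢ t → u ~[ i ] updateAt u i (const t)
  line {u} {i} ui≢t = (λ e → ui≢t (≡.trans e (updateAt-updates i u)))
                    , λ j j≢i → ≡.sym (updateAt-minimal j i u j≢i)

  corner-differs : i ≢ j → u ~[ i ] v → u ~[ j ] w → ¬ (v ≗ w ⊎ ∃ λ k → v ~[ k ] w)
  corner-differs {i} {j} i≢j (ui≢vi , uv) (uj≢wj , uw) (inj₁ v≗w) =
    ui≢vi (≡.trans (uw i i≢j) (≡.sym (v≗w i)))
  corner-differs {i} {j} i≢j (ui≢vi , uv) (uj≢wj , uw) (inj₂ (k , e)) = i≢j
    (≡.trans (differ⇒direction e λ vi≡wi → ui≢vi (≡.trans (uw i i≢j) (≡.sym vi≡wi)))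
      (≡.sym (differ⇒direction e λ vj≡wj → uj≢wj (≡.trans (uv j (i≢j ∘ ≡.sym)) vj≡wj))))

-- Coordinates are changed one at a time, so only directions in which `u` and `v` differ occur; `J`
-- keeps track of them. Reflexivity is up to `≗` because a vector and its reassembled head and tail
-- are compared pointwise.
path-induction : ∀ {d q} (J : Fin d → Set) (R : Vector (Fin q) d → Vector (Fin q) d → Set) →
                 (∀ {u v} → u ≗ v → R u v) → (∀ {u v w} → R u v → R v w → R u w) →
                 (∀ {u v} j → J j → u ~[ j ] v → R u v) →
                 ∀ u v → (∀ i → u i ≢ v i → J i) → R u v
path-induction {zero}  J R reflexive trans step u v allowed = reflexive λ ()
path-induction {suc d} J R reflexive trans step u v allowed =
  trans (reflexive (λ { zero → ≡.refl ; (suc i) → ≡.refl }))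
    (trans (first (head u ≟ᶠ head v))
      (trans (path-induction (J ∘ suc) (λ s t → R (head v ∷ᵛ s) (head v ∷ᵛ t))
        (λ p → reflexive λ { zero → ≡.refl ; (suc i) → p i })
        trans
        (λ j Jj (p , q) → step (suc j) Jj
          (p , λ { zero _ → ≡.refl ; (suc k) k≢j → q k (k≢j ∘ ≡.cong suc) }))
        (tail u) (tail v) (allowed ∘ suc))
      (reflexive (λ { zero → ≡.refl ; (suc i) → ≡.refl }))))
  where
  first : Dec (head u ≡ head v) → R (head u ∷ᵛ tail u) (head v ∷ᵛ tail u)
  first (yes p) = reflexive λ { zero → p ; (suc i) → ≡.refl }
  first (no  p) = step zero (allowed zero p)
    (p , λ { zero 0≢0 → contradiction ≡.refl 0≢0 ; (suc k) _ → ≡.refl })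

-- Edge directions under an automorphism of a Hamming graph

module Directions {d q : ℕ} (c : Group.Carrier (Sym (Graph.V (Hamming d (suc (suc q))))))
                  (c∈Aut : Subgroup.Mem (Aut (Hamming d (suc (suc q)))) c) where
  open Inverse c using (to; to-cong)

  private
    Tuple = Vector (Fin (suc (suc q))) d

    variable
      u u′ v v′ w z : Tuple
      i j k l : Fin d

  to-edge : u ~[ i ] v → ∃ λ k → to u ~[ k ] to v
  to-edge {u} {i} {v} e = Equivalence.to (c∈Aut u v) (i , e)

  to-injective : to u ≗ to v → u ≗ v
  to-injective = Injection.injective (Inverse⇒Injection c)

  -- Were the directions equal, the images of `v` and `w` would coincide or be adjacent, hence so
  -- would `v` and `w`, contrary to `corner-differs`.
  directions-differ : i ≢ j → u ~[ i ] v → u ~[ j ] w → to u ~[ k ] to v → to u ~[ l ] to w → k ≢ l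
  directions-differ {v = v} {w} {k} i≢j uv uw cuv cuw ≡.refl = corner-differs i≢j uv uw
    (Sum.map to-injective (λ cvw → Equivalence.from (c∈Aut v w) (k , cvw)) (two-steps cuv cuw))

  -- If `v` and `w` differ, they form a triangle with `u`, and so do the images; all sides of a
  -- triangle have one direction.
  same-direction : u ~[ i ] v → u ~[ i ] w → to u ~[ k ] to v → to u ~[ k ] to w
  same-direction {u} {i} {v} {w} uv uw cuv with two-steps uv uw
  ... | inj₁ v≗w = ~[]-resp (λ _ → ≡.refl) (to-cong v≗w) cuv
  ... | inj₂ vw with to-edge uw | to-edge (~[]-sym vw)
  ...   | l , cuw | _ , cwv = ≡.subst (to u ~[_] to w) (triangle cuv cuw cwv) cuw

  -- Opposite sides of a square of the image have the same direction, for
  -- otherwise the images of u and z would coincide.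
  square : i ≢ j → u ~[ i ] v → u ~[ j ] w → v ~[ j ] z → w ~[ i ] z →
           to u ~[ k ] to w → to v ~[ k ] to z
  square {i} {j} {u} {v} {w} {z} {k} i≢j uv uw vz wz cuw with to-edge uv | to-edge vz | to-edge wz
  ... | a , cuv | b , cvz | m , cwz = ≡.subst (to v ~[_] to z)
    (decidable-stable (b ≟ᶠ k) λ b≢k →
      let cuk≡czk : to u k ≡ to z k
          cuk≡czk = ≡.trans (proj₂ cuv k (directions-differ i≢j uv uw cuv cuw ∘ ≡.sym))
                            (proj₂ cvz k (b≢k ∘ ≡.sym))
          k≡m = differ⇒direction cwz λ cwk≡czk → proj₁ cuw (≡.trans cuk≡czk (≡.sym cwk≡czk))
          cu≗cz : to u ≗ to z
          cu≗cz l = case l ≟ᶠ k of λ where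
            (yes ≡.refl) → cuk≡czk
            (no  l≢k)    → ≡.trans (proj₂ cuw l l≢k) (proj₂ cwz l λ l≡m → l≢k (≡.trans l≡m (≡.sym k≡m)))
      in proj₁ uv (≡.trans (to-injective cu≗cz i) (≡.sym (proj₂ vz i i≢j))))
    cvz

  origin : Tuple
  origin _ = zero

  -- The letter `suc zero` exists since the alphabet has size `suc (suc q)`; thus each direction has
  -- an edge at the origin.
  origin-edge : ∀ i → origin ~[ i ] updateAt origin i (const (suc zero))
  origin-edge i = line λ ()

  -- Read off at the origin only; `to-direction` extends it to all vertices.
  σ : Fin d → Fin d
  σ i = proj₁ (to-edge (origin-edge i))

  private
    DirectedBy-σ : Tuple → Set
    DirectedBy-σ u = ∀ {i v} → u ~[ i ] v → to u ~[ σ i ] to v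

    at-origin : DirectedBy-σ origin
    at-origin {i} e = same-direction (origin-edge i) e (proj₂ (to-edge (origin-edge i)))

    respects : u ≗ v → DirectedBy-σ u → DirectedBy-σ v
    respects u≗v Du e = ~[]-resp (to-cong u≗v) (λ _ → ≡.refl)
      (Du (~[]-resp (λ i → ≡.sym (u≗v i)) (λ _ → ≡.refl) e))

    -- An edge at `u′` in the direction of the edge from `u` is compared with that edge itself; any
    -- other is the side of a square opposite to an edge at `u`.
    along : u ~[ j ] u′ → DirectedBy-σ u → DirectedBy-σ u′
    along {u} {j} {u′} uu′ Du {i} {v} u′v with i ≟ᶠ j
    ... | yes ≡.refl = same-direction (~[]-sym uu′) u′v (~[]-sym (Du uu′))
    ... | no i≢j = square (i≢j ∘ ≡.sym) uu′ ux u′v xv (Du ux)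
      where
      x : Tuple
      x = updateAt u i (const (v i))
      ux : u ~[ i ] x
      ux = line λ ui≡vi → proj₁ u′v (≡.trans (≡.sym (proj₂ uu′ i i≢j)) ui≡vi)
      xv : x ~[ j ] v
      xv = (λ xj≡vj → proj₁ uu′ (≡.trans (proj₂ ux j (i≢j ∘ ≡.sym))
              (≡.trans xj≡vj (≡.sym (proj₂ u′v j (i≢j ∘ ≡.sym))))))
         , λ k k≢j → case k ≟ᶠ i of λ where
             (yes ≡.refl) → updateAt-updates i u
             (no  k≢i)    → ≡.trans (≡.sym (proj₂ ux k k≢i))
               (≡.trans (proj₂ uu′ k k≢j) (proj₂ u′v k k≢i))

  to-direction : u ~[ i ] v → to u ~[ σ i ] to v
  to-direction {u} = path-induction (λ _ → ⊤) (λ u v → DirectedBy-σ u → DirectedBy-σ v)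
    (λ p → respects p) (λ f g → g ∘ f) (λ j _ e → along e) origin u (λ _ _ → tt) at-origin

-- Automorphisms of Hamming graphs as wreath product elements

module _ {d q : ℕ} where
  private
    Q : ℕ
    Q = suc (suc q)

    S-Q : Group 0ℓ 0ℓ
    S-Q = Sym (≡.setoid (Fin Q))

    wreath-action : Action (S-Q ≀S d) (Graph.V (Hamming d Q))
    wreath-action = productAction idᴴ d

    module Aut = Subgroup (Aut (Hamming d Q))
    module Sym = Group (Sym (Graph.V (Hamming d Q)))

  module Coordinates (c : Sym.Carrier) (c∈Aut : Aut.Mem c) (c⁻¹∈Aut : Aut.Mem (c Sym.⁻¹)) where
    open Inverse c using (to; to-cong; strictlyInverseʳ)
    private
      module D  = Directions c c∈Aut
      module D⁻ = Directions (c Sym.⁻¹) c⁻¹∈Aut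
    open D public using (σ)

    σ⁻σ : ∀ i → D⁻.σ (σ i) ≡ i
    σ⁻σ i = direction-unique
      (~[]-resp (strictlyInverseʳ _) (strictlyInverseʳ _)
        (D⁻.to-direction (D.to-direction (D.origin-edge i))))
      (D.origin-edge i)

    -- A path from `u` to `v` can avoid direction `i`; as `σ` is injective, the images of its edges
    -- leave coordinate `σ i` unchanged.
    coordinate : ∀ i u v → u i ≡ v i → to u (σ i) ≡ to v (σ i)
    coordinate i u v ui≡vi = path-induction (_≢ i) (λ u v → to u (σ i) ≡ to v (σ i))
      (λ p → to-cong p (σ i)) ≡.trans
      (λ j j≢i e → proj₂ (D.to-direction e) (σ i)
        (λ σi≡σj → j≢i (≡.trans (≡.sym (σ⁻σ j)) (≡.trans (≡.cong D⁻.σ (≡.sym σi≡σj)) (σ⁻σ i)))))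
      u v (λ j uj≢vj → λ { ≡.refl → uj≢vj ui≡vi })

  -- The k-th coordinate of c(u) depends on one coordinate of u only, so its values
  -- can be read off at constant tuples.
  Hamming-automorphism : ∀ c → Aut.Mem c →
    ∃ λ w → ∀ u → act wreath-action w u ≗ Inverse.to c u
  Hamming-automorphism c c∈Aut = (g , permutation) , λ u k → coordinate′ k _ u ≡.refl
    where
    open Inverse c using (to; from; strictlyInverseˡ; strictlyInverseʳ)
    c⁻¹∈Aut : Aut.Mem (c Sym.⁻¹)
    c⁻¹∈Aut = Aut.⁻¹-closed {c} c∈Aut
    module C  = Coordinates c c∈Aut c⁻¹∈Aut
    module C⁻ = Coordinates (c Sym.⁻¹) c⁻¹∈Aut c∈Aut
    σσ⁻ = C⁻.σ⁻σ

    permutation : Inverse (≡.setoid (Fin d)) (≡.setoid (Fin d))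
    permutation = mkPermutation (≡.setoid (Fin d)) C.σ C⁻.σ (≡.cong _) (≡.cong _) σσ⁻ C.σ⁻σ

    coordinate′ : ∀ k u v → u (C⁻.σ k) ≡ v (C⁻.σ k) → to u k ≡ to v k
    coordinate′ k u v p = ≡.subst (λ l → to u l ≡ to v l) (σσ⁻ k) (C.coordinate (C⁻.σ k) u v p)

    g : Fin d → Inverse (≡.setoid (Fin Q)) (≡.setoid (Fin Q))
    g k = mkPermutation (≡.setoid (Fin Q))
      (λ t → to (const t) k) (λ t → from (const t) (C⁻.σ k)) (≡.cong _) (≡.cong _)
      (λ t → ≡.trans (coordinate′ k _ (from (const t)) ≡.refl) (strictlyInverseˡ (const t) k))
      (λ t → ≡.trans (C⁻.coordinate k _ (to (const t)) ≡.refl) (strictlyInverseʳ (const t) (C⁻.σ k)))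

  productAction-preserves : ∀ w → Aut.Mem (wreath-action ⟨$⟩ w)
  productAction-preserves (g , σ) u v = mk⇔ forwards backwards
    where
    module σ = Inverse σ
    g-injective : ∀ i {x y} → Inverse.to (g i) x ≡ Inverse.to (g i) y → x ≡ y
    g-injective i = Injection.injective (Inverse⇒Injection (g i))
    w : Vector (Fin Q) d → Vector (Fin Q) d
    w = act wreath-action (g , σ)

    forwards : (∃ λ i → u ~[ i ] v) → ∃ λ i → w u ~[ i ] w v
    forwards (i , ui≢vi , agree) = σ.to i
      , (λ e → ui≢vi (≡.subst (λ j → u j ≡ v j) (σ.strictlyInverseʳ i) (g-injective (σ.to i) e)))
      , λ j j≢σi → ≡.cong (Inverse.to (g j)) (agree (σ.from j) λ σ⁻j≡i →
          j≢σi (≡.trans (≡.sym (σ.strictlyInverseˡ j)) (≡.cong σ.to σ⁻j≡i)))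

    backwards : (∃ λ i → w u ~[ i ] w v) → ∃ λ i → u ~[ i ] v
    backwards (i , wui≢wvi , agree) = σ.from i
      , (λ e → wui≢wvi (≡.cong (Inverse.to (g i)) e))
      , λ j j≢σ⁻i → ≡.subst (λ k → u k ≡ v k) (σ.strictlyInverseʳ j)
          (g-injective (σ.to j) (agree (σ.to j) λ σj≡i →
            j≢σ⁻i (≡.trans (≡.sym (σ.strictlyInverseʳ j)) (≡.cong σ.from σj≡i))))

  -- Constant tuples determine the letter permutations, and tuples with a single nonzero entry
  -- determine `σ`.
  productAction-faithful : Faithful wreath-action
  productAction-faithful (g , σ) trivial = g≈ε , σ≈ε
    where
    module σ = Inverse σ
    g≈ε : ∀ i x → Inverse.to (g i) x ≡ x
    g≈ε i x = trivial (const x) i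

    indicator : Fin d → Vector (Fin Q) d
    indicator i = updateAt (const zero) i (const (suc zero))

    σ⁻≈ε : ∀ i → σ.from i ≡ i
    -- Otherwise entry `i` of the image of `indicator i` would be `zero` instead of `suc zero`.
    σ⁻≈ε i = decidable-stable (σ.from i ≟ᶠ i) λ σ⁻i≢i →
      case ≡.trans (≡.sym (updateAt-minimal (σ.from i) i (const zero) σ⁻i≢i))
        (≡.trans (≡.sym (g≈ε i _)) (≡.trans (trivial (indicator i) i)
          (updateAt-updates i (const zero)))) of λ ()

    σ≈ε : ∀ i → σ.to i ≡ i
    σ≈ε i = ≡.trans (≡.cong σ.to (≡.sym (σ⁻≈ε i))) (σ.strictlyInverseˡ i)

-- Cartesian products

-- Edges of a Cartesian factor all of whose edges are spread are told apart from the
-- edges of a Hamming graph by spreadness, so automorphisms preserve the two kinds.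
module _ (X : Graph 0ℓ 0ℓ 0ℓ) (d q : ℕ) where
  private
    Δ = Hamming d q
    Γ′ = X □ Δ
    module X = Graph X
    module Δ = Graph Δ
    module Γ = Graph Γ′
    module Aut = Subgroup (Aut Γ′)
    module Sym = Group (Sym Γ.V)

  -- Every common neighbour lies on the line of the edge, in the same copy of the Hamming graph, and
  -- points of a line coincide or are adjacent.
  Hamming-edge-not-spread : ∀ {x y u v} → x X.≈ y → u Δ.~ v → ¬ Spread Γ′ (x , u) (y , v)
  Hamming-edge-not-spread {x} {y} {u} {v} x≈y (i , uv) (z , w , z-common , w-common , z≉w , z≁w) =
    case two-steps (proj₂ (on-line z z-common)) (proj₂ (on-line w w-common)) of λ where
      (inj₁ p) → z≉w (z≈w , p)
      (inj₂ e) → z≁w (inj₁ (z≈w , i , e))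
    where
    on-line : ∀ z → CommonNeighbour Γ′ (x , u) (y , v) z → x X.≈ proj₁ z × u ~[ i ] proj₂ z
    on-line (z , t) (inj₁ (x≈z , j , ut) , inj₁ (_ , k , tv)) =
      x≈z , ≡.subst (u ~[_] t) (triangle uv ut tv) ut
    on-line (z , t) (inj₁ (x≈z , _) , inj₂ (z~y , _)) =
      contradiction (proj₂ X.~-resp (X.≈-trans (X.≈-sym x≈z) x≈y) z~y) X.irrefl
    on-line (z , t) (inj₂ (x~z , _) , inj₁ (z≈y , _)) =
      contradiction (proj₁ X.~-resp (X.≈-trans z≈y (X.≈-sym x≈y)) x~z) X.irrefl
    on-line (z , t) (inj₂ (_ , u≗t) , inj₂ (_ , t≗v)) =
      contradiction uv (≗⇒¬~[] λ j → ≡.trans (u≗t j) (t≗v j))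
    z≈w : proj₁ z X.≈ proj₁ w
    z≈w = X.≈-trans (X.≈-sym (proj₁ (on-line z z-common))) (proj₁ (on-line w w-common))

  Spread-□ : ∀ {x y u v} → u Δ.≈ v → Spread X x y → Spread Γ′ (x , u) (y , v)
  Spread-□ {u = u} u≗v (z , w , (xz , zy) , (xw , wy) , z≉w , z≁w) =
    (z , u) , (w , u) , (inj₂ (xz , Δ.≈-refl) , inj₂ (zy , u≗v))
    , (inj₂ (xw , Δ.≈-refl) , inj₂ (wy , u≗v)) , z≉w ∘ proj₁
    , λ { (inj₁ (z≈w , _)) → z≉w z≈w ; (inj₂ (z~w , _)) → z≁w z~w }

  module _ (spread : ∀ x y → x X.~ y → Spread X x y) where

    -- The image of such an edge is again spread, hence is no Hamming edge.
    X-edge : ∀ f → Aut.Mem f → (let open Inverse f) → ∀ {x y u v} → x X.~ y → u Δ.≈ v →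
             proj₁ (to (x , u)) X.~ proj₁ (to (y , v)) × proj₂ (to (x , u)) Δ.≈ proj₂ (to (y , v))
    X-edge f f∈Aut {x} {y} {u} {v} x~y u≗v
      with Equivalence.to (f∈Aut (x , u) (y , v)) (inj₂ (x~y , u≗v))
    ... | inj₂ e = e
    ... | inj₁ (p , e) = contradiction
      (Spread-preserved Γ′ f f∈Aut {x , u} {y , v} (Spread-□ u≗v (spread x y x~y)))
      (Hamming-edge-not-spread p e)

    -- Were the image an edge of the `X` kind, `X-edge` for the inverse of `f` would make `u` and
    -- `v` equal.
    Hamming-edge : ∀ f → Aut.Mem f → (let open Inverse f) → ∀ {x y u v} → x X.≈ y → u Δ.~ v →
                   proj₁ (to (x , u)) X.≈ proj₁ (to (y , v)) × proj₂ (to (x , u)) Δ.~ proj₂ (to (y , v))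
    Hamming-edge f f∈Aut {x} {y} {u} {v} x≈y u~v
      with Equivalence.to (f∈Aut (x , u) (y , v)) (inj₁ (x≈y , u~v))
    ... | inj₁ e = e
    ... | inj₂ (e , p) = contradiction (proj₂ u~v) (≗⇒¬~[] λ i →
      ≡.trans (≡.sym (proj₂ (f.strictlyInverseʳ (x , u)) i))
        (≡.trans (proj₂ (X-edge (f Sym.⁻¹) (Aut.⁻¹-closed {f} f∈Aut) e p) i)
          (proj₂ (f.strictlyInverseʳ (y , v)) i)))
      where module f = Inverse f

    module _ (common : ∀ x y → ∃ (CommonNeighbour X x y)) where

      -- A common neighbour joins `x` and `y`, and by `X-edge` neither step changes the second
      -- coordinate of the image.
      Hamming-coordinate : ∀ f → Aut.Mem f → (let open Inverse f) →
                           ∀ x y u → proj₂ (to (x , u)) Δ.≈ proj₂ (to (y , u))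
      Hamming-coordinate f f∈Aut x y u with common x y
      ... | z , xz , zy = Δ.≈-trans {i = proj₂ (to (x , u))}
        (proj₂ (X-edge f f∈Aut xz Δ.≈-refl)) (proj₂ (X-edge f f∈Aut zy Δ.≈-refl))
        where open Inverse f

      X-coordinate : ∀ f → Aut.Mem f → (let open Inverse f) →
                     ∀ x u v → proj₁ (to (x , u)) X.≈ proj₁ (to (x , v))
      X-coordinate f f∈Aut x u v = path-induction (const ⊤)
        (λ u v → proj₁ (to (x , u)) X.≈ proj₁ (to (x , v)))
        (λ u≗v → proj₁ (to-cong (X.≈-refl , u≗v))) X.≈-trans
        (λ j _ e → proj₁ (Hamming-edge f f∈Aut X.≈-refl (j , e))) u v (λ _ _ → tt)
        where open Inverse f

      -- The factors of `f` are read off in the layers of `u₀` and `x₀`; `X-coordinate` and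
      -- `Hamming-coordinate` transfer the values to other layers.
      module Split (x₀ : X.Vertex) (u₀ : Δ.Vertex) (f : Sym.Carrier) (f∈Aut : Aut.Mem f) where
        open Inverse f
        private
          f⁻¹∈Aut : Aut.Mem (f Sym.⁻¹)
          f⁻¹∈Aut = Aut.⁻¹-closed {f} f∈Aut

        left : Inverse X.V X.V
        left = mkPermutation X.V (λ x → proj₁ (to (x , u₀))) (λ x → proj₁ (from (x , u₀)))
          (λ p → proj₁ (to-cong (p , Δ.≈-refl))) (λ p → proj₁ (from-cong (p , Δ.≈-refl)))
          (λ x → X.≈-trans (X-coordinate f f∈Aut _ _ _) (proj₁ (strictlyInverseˡ (x , u₀))))
          (λ x → X.≈-trans (X-coordinate (f Sym.⁻¹) f⁻¹∈Aut _ _ _) (proj₁ (strictlyInverseʳ (x , u₀))))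

        right : Inverse Δ.V Δ.V
        right = mkPermutation Δ.V (λ u → proj₂ (to (x₀ , u))) (λ u → proj₂ (from (x₀ , u)))
          (λ p → proj₂ (to-cong (X.≈-refl , p))) (λ p → proj₂ (from-cong (X.≈-refl , p)))
          (λ u i → ≡.trans (Hamming-coordinate f f∈Aut _ _ _ i) (proj₂ (strictlyInverseˡ (x₀ , u)) i))
          (λ u i → ≡.trans (Hamming-coordinate (f Sym.⁻¹) f⁻¹∈Aut _ _ _ i)
            (proj₂ (strictlyInverseʳ (x₀ , u)) i))

        left∈Aut : Subgroup.Mem (Aut X) left
        left∈Aut x y = mk⇔ (λ e → proj₁ (X-edge f f∈Aut e Δ.≈-refl)) λ e →
          -- The images agree in the second coordinate, so they are adjacent in the product, and `f`
          -- reflects edges.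
          case Equivalence.from (f∈Aut (x , u₀) (y , u₀)) (inj₂ (e , Hamming-coordinate f f∈Aut x y u₀)) of λ where
            (inj₁ (_ , u₀~u₀)) → contradiction u₀~u₀ Δ.irrefl
            (inj₂ (x~y , _))   → x~y

        right∈Aut : Subgroup.Mem (Aut Δ) right
        right∈Aut u v = mk⇔ (λ e → proj₂ (Hamming-edge f f∈Aut X.≈-refl e)) λ e →
          case Equivalence.from (f∈Aut (x₀ , u) (x₀ , v)) (inj₁ (X-coordinate f f∈Aut x₀ u v , e)) of λ where
            (inj₁ (_ , u~v))   → u~v
            (inj₂ (x₀~x₀ , _)) → contradiction x₀~x₀ X.irrefl

        splits : ∀ x u → (Inverse.to left x , Inverse.to right u) Γ.≈ to (x , u)
        splits x u = X-coordinate f f∈Aut x u₀ u , Hamming-coordinate f f∈Aut x₀ x u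

-- The automorphism group of Γ_d and its regular subgroups

module _ (d : ℕ) where
  private
    Δ = Hamming d 6
    module Γ = Graph (Γ d)
    module AutΓ = Subgroup (Aut (Γ d))
    G = A ×ᴳ W d

    u₀ : Graph.Vertex Δ
    u₀ _ = zero

  open Split X₁₄ d 6 X₁₄-spread X₁₄-common εᶠ u₀

  Γ-faithful : Faithful (Γ-action d)
  Γ-faithful (a , w) trivial = (λ x → proj₁ (trivial (x , u₀)))
    , productAction-faithful w (λ u → proj₂ (trivial (εᶠ , u)))

  AutΓ≐A×W : AutΓ.Mem ≐ Subgroup.Mem (image (Γ-action d) (whole G))
  AutΓ≐A×W = (λ {f} → factor f) , λ {f} ((a , w) , _ , aw≈f) →
    AutΓ.resp {Γ-action d ⟨$⟩ (a , w)} {f} aw≈f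
      (□-automorphism X₁₄ Δ (proj₁ a) (W-action d ⟨$⟩ w) (proj₂ a) (productAction-preserves w))
    where
    factor : ∀ f → AutΓ.Mem f → Subgroup.Mem (image (Γ-action d) (whole G)) f
    factor f f∈Aut =
      let w , w≗right = Hamming-automorphism (right f f∈Aut) (right∈Aut f f∈Aut)
      in ((left f f∈Aut , left∈Aut f f∈Aut) , w) , tt , λ (x , u) →
        Γ.≈-trans {i = _ , act (W-action d) w u} (≡.refl , w≗right u) (splits f f∈Aut x u)

  -- The action being faithful with image `Aut (Γ d)`, a regular `P` pulls back to a regular
  -- subgroup of `A ×ᴳ W d`, where `RegularSubgroup` applies; conversely regularity of `R d H φ`
  -- passes to its image.
  regular-subgroups : (P : Subgroup (Sym Γ.V)) →
    (Subgroup.Mem P ⊆ AutΓ.Mem × IsRegular idᴴ P)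
      ⇔
    (Σ[ H ∈ Subgroup (W d) ] IsRegular (W-action d) H × Σ[ φ ∈ Hom A (N/ H) ]
       Subgroup.Mem P ≐ Subgroup.Mem (image (Γ-action d) (R d H φ)))
  regular-subgroups P = mk⇔ forwards backwards
    where
    ρ = Γ-action d

    forwards : Subgroup.Mem P ⊆ AutΓ.Mem × IsRegular idᴴ P →
      Σ[ H ∈ Subgroup (W d) ] IsRegular (W-action d) H × Σ[ φ ∈ Hom A (N/ H) ]
        Subgroup.Mem P ≐ Subgroup.Mem (image ρ (R d H φ))
    forwards (P⊆Aut , regular) = H , H-regular , φ
      , (λ {p} p∈P → image-mono ρ K (R d H φ) (λ {g} → proj₁ K≐cosetGraph {g}) {p} (proj₁ P≐image {p} p∈P))
      , λ {p} p∈R → proj₂ P≐image {p} (image-mono ρ (R d H φ) K (λ {g} → proj₂ K≐cosetGraph {g}) {p} p∈R)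
      where
      P⊆image : Subgroup.Mem P ⊆ Subgroup.Mem (image ρ (whole G))
      P⊆image {p} p∈P = proj₁ AutΓ≐A×W {p} (P⊆Aut {p} p∈P)
      K : Subgroup G
      K = preimage ρ P
      P≐image : Subgroup.Mem P ≐ Subgroup.Mem (image ρ K)
      P≐image = image-preimage ρ P (λ {p} → P⊆image {p})
      open RegularSubgroup A-action (W-action d) (λ x {a} → A-free x {a}) εᶠ u₀ K
        (preimage-regular ρ Γ-faithful P (λ {p} → P⊆image {p}) regular)

    backwards : (Σ[ H ∈ Subgroup (W d) ] IsRegular (W-action d) H × Σ[ φ ∈ Hom A (N/ H) ]
        Subgroup.Mem P ≐ Subgroup.Mem (image ρ (R d H φ))) →
      Subgroup.Mem P ⊆ AutΓ.Mem × IsRegular idᴴ P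
    backwards (H , regular , φ , P⊆R , R⊆P) =
        (λ {p} p∈P → proj₂ AutΓ≐A×W {p} (image-mono ρ (R d H φ) (whole G) (λ _ → tt) {p} (P⊆R {p} p∈P)))
      , regular-resp idᴴ (image ρ (R d H φ)) P ((λ {p} → R⊆P {p}) , λ {p} → P⊆R {p})
          (image-regular ρ (R d H φ) (cosetGraph-regular A-action (W-action d) H φ
            A-transitive (λ x {a} → A-free x {a}) regular))

  F₂₀-quotient : (H : Subgroup (W d)) (φ : Hom A (N/ H)) →
                 Σ[ M ∈ NormalSubgroup ⌊ R d H φ ⌋ ] ⌊ R d H φ ⌋ /ᴳ M ≅ F₂₀
  F₂₀-quotient H φ = quotient≅ {⌊ R d H φ ⌋} {A} {F₂₀} proj-A proj-A-surjective A≅F₂₀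
    where
    proj-A : Hom ⌊ R d H φ ⌋ A
    proj-A = cosetGraph-proj₁ {A} {W d} H φ
    proj-A-surjective : ∀ a → ∃ λ r → Group._≈_ A (proj-A ⟨$⟩ r) a
    proj-A-surjective = cosetGraph-proj₁-surjective {A} {W d} H φ

  automorphism-translates : ∀ f → AutΓ.Mem f → ∀ x u →
    proj₁ (Inverse.to f (x , u)) ≡ x ∙ᶠ proj₁ (Inverse.to f (εᶠ , u₀))
  automorphism-translates f f∈Aut x u = ≡.trans (≡.sym (proj₁ (splits f f∈Aut x u)))
    (automorphism-is-translation (left f f∈Aut , left∈Aut f f∈Aut) x)

  -- Exclusion of abelian groups

  module _ {c ℓ s : Level} (K : AbelianGroup c ℓ) where
    private
      module K = AbelianGroup K
      module Kₚ = GroupProperties K.group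

    not-abelian : ¬ IsCayleyGraphOf s (Γ d) K.group
    -- The two sides compute to `(1 , 1)` and `(2 , 1)`.
    not-abelian (S , iso , preserves) = contradiction a∙b≡b∙a λ ()
      where
      module C = Graph (Cay K.group S)
      open Inverse iso

      K-translation : K.Carrier → Inverse K.setoid K.setoid
      K-translation k = record
        { to = K._∙ k ; from = K._∙ k K.⁻¹ ; to-cong = K.∙-congʳ ; from-cong = K.∙-congʳ
        ; inverse = (λ p → K.trans (K.∙-congʳ p) (Kₚ.//-rightDividesˡ k _))
                  , (λ p → K.trans (K.∙-congʳ p) (Kₚ.//-rightDividesʳ k _))
        }

      translate : K.Carrier → Inverse Γ.V Γ.V
      translate k = FC.inverse (FC.inverse iso (K-translation k)) (FS.inverse iso)

      from-preserves : ∀ x y → x C.~ y → from x Γ.~ from y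
      from-preserves x y e = Equivalence.from (preserves _ _)
        (proj₂ C.~-resp (K.sym (strictlyInverseˡ x)) (proj₁ C.~-resp (K.sym (strictlyInverseˡ y)) e))

      from-reflects : ∀ x y → from x Γ.~ from y → x C.~ y
      from-reflects x y e = proj₂ C.~-resp (strictlyInverseˡ x)
        (proj₁ C.~-resp (strictlyInverseˡ y) (Equivalence.to (preserves _ _) e))

      translate∈Aut : ∀ k → AutΓ.Mem (translate k)
      translate∈Aut k u v = mk⇔
        (λ e → from-preserves _ _ (Equivalence.to translation (Equivalence.to (preserves u v) e)))
        (λ e → Equivalence.from (preserves u v) (Equivalence.from translation (from-reflects _ _ e)))
        where translation = translation-preserves K.group S k (to u) (to v)

      o : Γ.Vertex
      o = εᶠ , u₀

      difference : F₂₀-elem → K.Carrier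
      difference x = to o K.⁻¹ K.∙ to (x , u₀)

      translate-o : ∀ x → Inverse.to (translate (difference x)) o Γ.≈ (x , u₀)
      translate-o x = Γ.≈-trans {k = x , u₀}
        (from-cong (Kₚ.\\-leftDividesˡ (to o) (to (x , u₀)))) (strictlyInverseʳ (x , u₀))

      translate-∙ : ∀ k l v →
        Inverse.to (translate l) (Inverse.to (translate k) v) Γ.≈ from (to v K.∙ (k K.∙ l))
      translate-∙ k l v = from-cong (K.trans (K.∙-congʳ (strictlyInverseˡ _)) (K.assoc _ _ _))

      -- Two translations are applied in succession to `o`: the first yields first coordinate `x`,
      -- and the second, being an automorphism, multiplies it on the right by `y`.
      product : ∀ x y → proj₁ (from (to o K.∙ (difference x K.∙ difference y))) ≡ x ∙ᶠ y
      product x y = ≡.trans (≡.sym (proj₁ (translate-∙ (difference x) (difference y) o)))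
        (≡.trans (automorphism-translates (translate (difference y)) (translate∈Aut (difference y)) _ _)
          (≡.cong₂ _∙ᶠ_ (proj₁ (translate-o x)) (proj₁ (translate-o y))))

      a b : F₂₀-elem
      a = # 1 , # 0
      b = # 0 , # 1

      a∙b≡b∙a : a ∙ᶠ b ≡ b ∙ᶠ a
      a∙b≡b∙a = ≡.trans (≡.sym (product a b))
        (≡.trans (proj₁ (from-cong (K.∙-congˡ (K.comm _ _)))) (product b a))

theorem7p2 : ∀ {c ℓ s : Level} (d : ℕ) →
    (A ≅ F₂₀)
    × (Faithful (Γ-action d) × Subgroup.Mem (Aut (Γ d)) ≐ Subgroup.Mem (image (Γ-action d) (whole (A ×ᴳ W d))))
    × (∀ (P : Subgroup (Sym (Graph.V (Γ d)))) →
    (Subgroup.Mem P ⊆ Subgroup.Mem (Aut (Γ d)) × IsRegular idᴴ P)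
    ⇔
    (Σ[ H ∈ Subgroup (W d) ] IsRegular (W-action d) H × Σ[ φ ∈ Hom A (N/ H) ]
    Subgroup.Mem P ≐ Subgroup.Mem (image (Γ-action d) (R d H φ))))
    × (∀ (H : Subgroup (W d)) (regular : IsRegular (W-action d) H) (φ : Hom A (N/ H)) →
    (∀ (ω₀ : Graph.Vertex (Hamming d 6)) →
    ⌊ R d H φ ⌋ ≅ ⌊ H ⌋ ⋊[ quotientEmbedding (W-action d) H regular ω₀ ∘ᴴ φ ] A)
    × (Σ[ M ∈ NormalSubgroup ⌊ R d H φ ⌋ ] ⌊ R d H φ ⌋ /ᴳ M ≅ F₂₀))
    × (∀ (K : AbelianGroup c ℓ) → ¬ IsCayleyGraphOf s (Γ d) (AbelianGroup.group K))
theorem7p2 d =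
    A≅F₂₀
  , (Γ-faithful d , AutΓ≐A×W d)
  , regular-subgroups d
  , (λ H regular φ → cosetGraph≅semidirect (W-action d) H regular φ , F₂₀-quotient d H φ)
  , not-abelian d
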